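{- Let $(a_n)_{n\ge0}$ be the sequence, listed in increasing order, of the non-negative integers $m$ such that $240m+49$ is a perfect square. Then $$\sum_{n=0}^\infty(-1)^{\lfloor 5n/4\rfloor}q^{a_n}=\frac{(q,q^7,q^8;q^8)_\infty\,(q^6,q^{10};q^{16})_\infty}{(q^2,q^3;q^5)_\infty}.$$
   Context: Here $q$ is a complex number with $|q|<1$ (equivalently, the identity may be read as an identity of formal power series in $q$). For a complex number $a$, $(a;q)_\infty:=\prod_{i=0}^\infty(1-aq^i)$, and $(a_1,a_2,\dots,a_m;q)_\infty:=\prod_{j=1}^m(a_j;q)_\infty$. $\lfloor x\rfloor$ is the floor function. -}

module Defs where

open import Data.Nat using (ℕ; zero; suc; _+_; _*_; _∸_; _≡ᵇ_)
open import Data.Nat.DivMod using (_/_; _%_)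
open import Data.Integer using (ℤ; +_; -[1+_]) renaming (_+_ to _+ℤ_; _*_ to _*ℤ_; _-_ to _-ℤ_; -_ to -ℤ_)
open import Data.Bool using (if_then_else_)
open import Data.List using (List; []; _∷_; zipWith; upTo; foldr)

-- Formal power series over ℤ, represented by their coefficient functions.
PS : Set
PS = ℕ → ℤ

Σ< : ℕ → (ℕ → ℤ) → ℤ
Σ< zero    f = + 0
Σ< (suc n) f = Σ< n f +ℤ f n

mono : ℕ → PS
mono e n = if e ≡ᵇ n then + 1 else + 0

one : PS
one = mono 0

_⊝_ : PS → PS → PS
(f ⊝ g) n = f n -ℤ g n

_⊛_ : PS → PS → PS
(f ⊛ g) n = Σ< (suc n) (λ k → f k *ℤ g (n ∸ k))
infixl 7 _⊛_

finprod : (ℕ → PS) → ℕ → PS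
finprod F zero    = one
finprod F (suc i) = finprod F i ⊛ F i

-- (q^r ; q^k)_∞ = ∏_{i ≥ 0} (1 - q^{r + k i}) as a formal power series,
-- for r ≥ 1, k ≥ 1: the factors with i ≥ n have exponent > n, so the
-- coefficient of q^n equals that of the finite product over i ≤ n.
poch : ℕ → ℕ → PS
poch r k n = finprod (λ i → one ⊝ mono (r + k * i)) (suc n) n

-- Multiplicative inverse of a power series with constant term 1:
-- b_0 = 1, b_n = - Σ_{j=1}^{n} f j * b_{n-j}.
-- invCoeffs f n = [b_n, b_{n-1}, ..., b_0]
invCoeffs : PS → ℕ → List ℤ
invCoeffs f zero    = + 1 ∷ []
invCoeffs f (suc n) =
  let bs = invCoeffs f n in
  (-ℤ foldr _+ℤ_ (+ 0) (zipWith (λ j b → f (suc j) *ℤ b) (upTo (suc n)) bs)) ∷ bs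

inv : PS → PS
inv f n with invCoeffs f n
... | b ∷ _ = b
... | []    = + 0

sgn : ℕ → ℤ
sgn n with (5 * n / 4) % 2
... | zero = + 1
... | suc _ = -[1+ 0 ]

-- For a strictly increasing a : ℕ → ℕ (so a n ≥ n), the formal series
-- Σ_{n ≥ 0} (-1)^{⌊5n/4⌋} q^{a n}; its coefficient of q^N only receives
-- contributions from n ≤ N.
lhsSeries : (ℕ → ℕ) → PS
lhsSeries a N = Σ< (suc N) (λ n → if a n ≡ᵇ N then sgn n else + 0)

rhsSeries : PS
rhsSeries =
  (poch 1 8 ⊛ poch 7 8 ⊛ poch 8 8 ⊛ poch 6 16 ⊛ poch 10 16)
    ⊛ inv (poch 2 5 ⊛ poch 3 5)

{-# OPTIONS --safe #-}

-- Write f(a,b) = (q^a, q^b, q^{a+b}; q^{a+b})_∞ and D = (q², q³; q⁵)_∞. The squares congruent to 49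
-- modulo 240 are the squares of 120 j + c with j ∈ ℤ and c = 7, 17, 23, 47, so that the left-hand side
-- is the theta series
--   L = Σ_j (q^{60j²+7j} - q^{60j²+17j+1} + q^{60j²+23j+2} - q^{60j²+47j+9}).
-- The numerator P of the right-hand side and the quotient S = (q²; q²)_∞ / D = f(4,6) / (q³, q⁷; q¹⁰)_∞
-- are quintuple products, hence theta series as well. The theorem L D = P follows from
--   f(1,7) f(6,10) = P (q¹⁶; q¹⁶)_∞,   S f(3,7) = f(4,6) (q¹⁰; q¹⁰)_∞,   L (q²; q²)_∞ = P S,
-- in which every factor is a theta series by the Jacobi triple product. Both sides of each identity are
-- sums over ℤ² of ± q^{Q(x,y)} with Q quadratic, and multiplication by an element of ℚ(√-2), ℚ(√-3)
-- or ℚ(√-5) carries one form to the other: after splitting the lattices by a residue modulo 2 or 3, the pieces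
-- of the two sides cancel in pairs under unimodular changes of variables.
module Submission where

open import Defs
open import Algebra.Bundles using (AbelianGroup; CommutativeMonoid)
open import Algebra.Properties.Group using (∙-cancelʳ)
import Algebra.Solver.CommutativeMonoid as CommutativeMonoidSolver
open import Data.Bool using (true; false; if_then_else_; T)
open import Data.Fin as Fin using (Fin; toℕ; fromℕ<; #_)
import Data.Fin.Properties as Finₚ
open import Data.Integer as ℤ using (ℤ; +_; -[1+_])
open import Data.Integer.DivMod using (_/ℕ_; n%ℕd<d; a≡a%ℕn+[a/ℕn]*n)
import Data.Integer.Properties as ℤₚ
open import Data.Integer.Tactic.RingSolver using (solve-∀)
open import Data.List using (List; []; _∷_; _++_; map; upTo; applyUpTo; tabulate; concatMap; foldr; zipWith; deduplicate; cartesianProduct)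
open import Data.List.Membership.Propositional using (_∈_)
import Data.List.Membership.Propositional.Properties as ∈
open import Data.List.Relation.Unary.All using (All; []; _∷_)
open import Data.List.Relation.Unary.AllPairs using ([]; _∷_)
open import Data.List.Relation.Unary.Any using (here; there)
open import Data.List.Relation.Unary.Unique.DecPropositional.Properties using (deduplicate-!)
open import Data.List.Relation.Unary.Unique.Propositional using (Unique)
import Data.List.Relation.Unary.Unique.Propositional.Properties as Unique
open import Data.Maybe using (Maybe; just; nothing)
open import Data.Nat as ℕ using (ℕ; zero; suc; _+_; _*_; _∸_; _≤_; _<_; z≤n; s≤s; _≡ᵇ_; _<ᵇ_; NonZero)
open import Data.Nat.DivMod using (_/_; _%_; m≡m%n+[m/n]*n; m%n<n; [m+kn]%n≡m%n; +-distrib-/-∣ˡ)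
open import Data.Nat.Divisibility using (divides)
import Data.Nat.Properties as ℕₚ
open import Data.Nat.Tactic.RingSolver using () renaming (solve-∀ to ℕ-solve-∀)
open import Data.Product using (∃; _×_; _,_; proj₁; proj₂)
import Data.Product.Properties as Prod
open import Data.Sum as Sum using (_⊎_; inj₁; inj₂)
open import Data.Unit using (⊤; tt)
open import Data.Vec using (Vec; lookup; []; _∷_)
import Data.Vec.Properties as Vec
open import Function using (_∘_; id)
open import Function.Bundles using (_⇔_; Equivalence)
open import Relation.Binary.Bundles using (Setoid)
open import Relation.Binary.Definitions using (DecidableEquality)
open import Relation.Binary.PropositionalEquality using (_≡_; _≢_; _≗_; refl; sym; trans; cong; cong₂; subst; subst₂; _→-setoid_; module ≡-Reasoning)
open import Relation.Nullary using (Dec; yes; no; contradiction)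
open import Relation.Nullary.Decidable using (does; map′; from-yes; _→-dec_)

-- The ring of formal power series

-- Multiplying by (q⁵; q⁵)_∞ would also make D a theta series, namely f(2,3), but then the exponents
-- on the two sides belong to the forms k² + 6v² and 5(s² + 10t²), which are not equivalent over ℚ.
-- Multiplying by (q²; q²)_∞ = S D gives k² + 20V² and 5s² + 16m² instead, both attached to ℚ(√-5).
-- This is the reason for S. The sum over a piece of a lattice is never evaluated. Two pieces with
-- opposite weights and the same quadratic polynomial cancel because a locally finite sum has only
-- one value, so each of the three identities becomes a finite computation with integer
-- coefficients. The price is that partners must be brought to literally the same polynomial; the
-- certificates record the changes of variables that do this. Quotients of products are handled by
-- multiplying out and cancelling a series with constant term 1.

Σ<-cong : ∀ n {f g : ℕ → ℤ} → (∀ k → k < n → f k ≡ g k) → Σ< n f ≡ Σ< n g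
Σ<-cong zero    eq = refl
Σ<-cong (suc n) eq =
  cong₂ ℤ._+_ (Σ<-cong n (λ k k<n → eq k (ℕₚ.m<n⇒m<1+n k<n))) (eq n ℕₚ.≤-refl)

Σ<-head : ∀ n f → Σ< (suc n) f ≡ f 0 ℤ.+ Σ< n (f ∘ suc)
Σ<-head zero    f = ℤₚ.+-comm (+ 0) (f 0)
Σ<-head (suc n) f =
  trans (cong (ℤ._+ f (suc n)) (Σ<-head n f)) (ℤₚ.+-assoc (f 0) _ _)

Σ<-+ : ∀ n f g → Σ< n (λ k → f k ℤ.+ g k) ≡ Σ< n f ℤ.+ Σ< n g
Σ<-+ zero    f g = refl
Σ<-+ (suc n) f g = trans (cong (ℤ._+ (f n ℤ.+ g n)) (Σ<-+ n f g)) (interchange (Σ< n f) (Σ< n g) (f n) (g n))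
  where
  interchange : ∀ a b c d → (a ℤ.+ b) ℤ.+ (c ℤ.+ d) ≡ (a ℤ.+ c) ℤ.+ (b ℤ.+ d)
  interchange = solve-∀

Σ<-*ˡ : ∀ n c f → Σ< n (λ k → c ℤ.* f k) ≡ c ℤ.* Σ< n f
Σ<-*ˡ zero    c f = sym (ℤₚ.*-zeroʳ c)
Σ<-*ˡ (suc n) c f =
  trans (cong (ℤ._+ (c ℤ.* f n)) (Σ<-*ˡ n c f)) (sym (ℤₚ.*-distribˡ-+ c _ _))

infixl 6 _⊕_
infixr 8 _•_

𝟘 : PS
𝟘 _ = + 0

_⊕_ : PS → PS → PS
(f ⊕ g) n = f n ℤ.+ g n

_•_ : ℤ → PS → PS
(c • f) n = c ℤ.* f n

tail : PS → PS
tail f n = f (suc n)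

⊛-head : ∀ f g n → (f ⊛ g) (suc n) ≡ f 0 ℤ.* g (suc n) ℤ.+ (tail f ⊛ g) n
⊛-head f g n = Σ<-head (suc n) _

⊛-last : ∀ f g n → (f ⊛ g) (suc n) ≡ (f ⊛ tail g) n ℤ.+ f (suc n) ℤ.* g 0
⊛-last f g n = cong₂ ℤ._+_
  (Σ<-cong (suc n) (λ k k≤n → cong (λ m → f k ℤ.* g m) (ℕₚ.+-∸-assoc 1 (ℕₚ.≤-pred k≤n))))
  (cong (λ m → f (suc n) ℤ.* g m) (ℕₚ.n∸n≡0 (suc n)))

⊛-cong≤ : ∀ n {f f′ g g′ : PS} → (∀ i → i ≤ n → f i ≡ f′ i) → (∀ i → i ≤ n → g i ≡ g′ i) →
          (f ⊛ g) n ≡ (f′ ⊛ g′) n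
⊛-cong≤ n p q = Σ<-cong (suc n) λ k k<n →
  cong₂ ℤ._*_ (p k (ℕₚ.≤-pred k<n)) (q (n ∸ k) (ℕₚ.m∸n≤m n k))

⊛-cong : ∀ {f f′ g g′ : PS} → f ≗ f′ → g ≗ g′ → f ⊛ g ≗ f′ ⊛ g′
⊛-cong p q n = ⊛-cong≤ n (λ i _ → p i) (λ i _ → q i)

⊛-congˡ : ∀ (f : PS) {g g′ : PS} → g ≗ g′ → f ⊛ g ≗ f ⊛ g′
⊛-congˡ f = ⊛-cong {f} {f} (λ _ → refl)

⊛-congʳ : ∀ {f f′ : PS} (g : PS) → f ≗ f′ → f ⊛ g ≗ f′ ⊛ g
⊛-congʳ g p = ⊛-cong {g = g} {g} p (λ _ → refl)

⊛-distribˡ : ∀ f g h → f ⊛ (g ⊕ h) ≗ (f ⊛ g) ⊕ (f ⊛ h)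
⊛-distribˡ f g h n = trans
  (Σ<-cong (suc n) (λ k _ → ℤₚ.*-distribˡ-+ (f k) _ _)) (Σ<-+ (suc n) _ _)

⊛-•ʳ : ∀ c f g → f ⊛ (c • g) ≗ c • (f ⊛ g)
⊛-•ʳ c f g n = trans (Σ<-cong (suc n) (λ k _ → swap (f k) c _)) (Σ<-*ˡ (suc n) c _)
  where
  swap : ∀ x y z → x ℤ.* (y ℤ.* z) ≡ y ℤ.* (x ℤ.* z)
  swap = solve-∀

-- The first term of one product is the last term of the other, and what remains is the same claim
-- one degree lower, with `tail f` in place of `f`.
⊛-comm : ∀ f g → f ⊛ g ≗ g ⊛ f
⊛-comm f g zero    = cong (λ z → + 0 ℤ.+ z) (ℤₚ.*-comm (f 0) (g 0))
⊛-comm f g (suc n) = begin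
  (f ⊛ g) (suc n)                              ≡⟨ ⊛-head f g n ⟩
  f 0 ℤ.* g (suc n) ℤ.+ (tail f ⊛ g) n         ≡⟨ ℤₚ.+-comm (f 0 ℤ.* g (suc n)) _ ⟩
  (tail f ⊛ g) n ℤ.+ f 0 ℤ.* g (suc n)         ≡⟨ cong₂ ℤ._+_ (⊛-comm (tail f) g n) (ℤₚ.*-comm (f 0) _) ⟩
  (g ⊛ tail f) n ℤ.+ g (suc n) ℤ.* f 0         ≡⟨ ⊛-last g f n ⟨
  (g ⊛ f) (suc n)                              ∎
  where open ≡-Reasoning

⊛-distribʳ : ∀ f g h → (f ⊕ g) ⊛ h ≗ (f ⊛ h) ⊕ (g ⊛ h)
⊛-distribʳ f g h n = begin
  ((f ⊕ g) ⊛ h) n            ≡⟨ ⊛-comm (f ⊕ g) h n ⟩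
  (h ⊛ (f ⊕ g)) n            ≡⟨ ⊛-distribˡ h f g n ⟩
  ((h ⊛ f) ⊕ (h ⊛ g)) n      ≡⟨ cong₂ ℤ._+_ (⊛-comm h f n) (⊛-comm h g n) ⟩
  ((f ⊛ h) ⊕ (g ⊛ h)) n      ∎
  where open ≡-Reasoning

⊛-•ˡ : ∀ c f g → (c • f) ⊛ g ≗ c • (f ⊛ g)
⊛-•ˡ c f g n = trans (⊛-comm (c • f) g n)
  (trans (⊛-•ʳ c g f n) (cong (c ℤ.*_) (⊛-comm g f n)))

-- Since `tail (f ⊛ g)` is `f 0 • tail g ⊕ tail f ⊛ g`, peeling off constant terms reduces degree n
-- + 1 for `f` to degree n for `tail f`.
⊛-assoc : ∀ f g h → (f ⊛ g) ⊛ h ≗ f ⊛ (g ⊛ h)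
⊛-assoc f g h zero    = lemma (f 0) (g 0) (h 0)
  where
  lemma : ∀ a b c → + 0 ℤ.+ (+ 0 ℤ.+ a ℤ.* b) ℤ.* c ≡ + 0 ℤ.+ a ℤ.* (+ 0 ℤ.+ b ℤ.* c)
  lemma = solve-∀
⊛-assoc f g h (suc n) = begin
  ((f ⊛ g) ⊛ h) (suc n)
    ≡⟨ ⊛-head (f ⊛ g) h n ⟩
  (f ⊛ g) 0 ℤ.* h (suc n) ℤ.+ (tail (f ⊛ g) ⊛ h) n
    ≡⟨ cong (λ z → (f ⊛ g) 0 ℤ.* h (suc n) ℤ.+ z) step ⟩
  (f ⊛ g) 0 ℤ.* h (suc n) ℤ.+ (f 0 ℤ.* (tail g ⊛ h) n ℤ.+ (tail f ⊛ (g ⊛ h)) n)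
    ≡⟨ lemma (f 0) (g 0) (h (suc n)) _ _ ⟩
  f 0 ℤ.* (g 0 ℤ.* h (suc n) ℤ.+ (tail g ⊛ h) n) ℤ.+ (tail f ⊛ (g ⊛ h)) n
    ≡⟨ cong (λ z → f 0 ℤ.* z ℤ.+ (tail f ⊛ (g ⊛ h)) n) (⊛-head g h n) ⟨
  f 0 ℤ.* (g ⊛ h) (suc n) ℤ.+ (tail f ⊛ (g ⊛ h)) n
    ≡⟨ ⊛-head f (g ⊛ h) n ⟨
  (f ⊛ (g ⊛ h)) (suc n) ∎
  where
  open ≡-Reasoning
  lemma : ∀ a b c d e → (+ 0 ℤ.+ a ℤ.* b) ℤ.* c ℤ.+ (a ℤ.* d ℤ.+ e) ≡ a ℤ.* (b ℤ.* c ℤ.+ d) ℤ.+ e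
  lemma = solve-∀
  step : (tail (f ⊛ g) ⊛ h) n ≡ f 0 ℤ.* (tail g ⊛ h) n ℤ.+ (tail f ⊛ (g ⊛ h)) n
  step = begin
    (tail (f ⊛ g) ⊛ h) n
      ≡⟨ ⊛-congʳ h (⊛-head f g) n ⟩
    (((f 0 • tail g) ⊕ (tail f ⊛ g)) ⊛ h) n
      ≡⟨ ⊛-distribʳ (f 0 • tail g) (tail f ⊛ g) h n ⟩
    ((f 0 • tail g) ⊛ h) n ℤ.+ ((tail f ⊛ g) ⊛ h) n
      ≡⟨ cong₂ ℤ._+_ (⊛-•ˡ (f 0) (tail g) h n) (⊛-assoc (tail f) g h n) ⟩
    f 0 ℤ.* (tail g ⊛ h) n ℤ.+ (tail f ⊛ (g ⊛ h)) n ∎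

mono-< : ∀ e n → n < e → mono e n ≡ + 0
mono-< (suc e) zero    _         = refl
mono-< (suc e) (suc n) (s≤s n<e) = mono-< e n n<e

⊛-zeroˡ : ∀ f → 𝟘 ⊛ f ≗ 𝟘
⊛-zeroˡ f n = ⊛-•ˡ (+ 0) 𝟘 f n

⊛-zeroʳ : ∀ f → f ⊛ 𝟘 ≗ 𝟘
⊛-zeroʳ f n = trans (⊛-comm f 𝟘 n) (⊛-zeroˡ f n)

⊛-identityˡ : ∀ f → one ⊛ f ≗ f
⊛-identityˡ f zero    = trans (ℤₚ.+-identityˡ _) (ℤₚ.*-identityˡ (f 0))
⊛-identityˡ f (suc n) = begin
  (one ⊛ f) (suc n)                           ≡⟨ ⊛-head one f n ⟩
  + 1 ℤ.* f (suc n) ℤ.+ (tail one ⊛ f) n      ≡⟨ cong₂ ℤ._+_ (ℤₚ.*-identityˡ (f (suc n))) (⊛-zeroˡ f n) ⟩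
  f (suc n) ℤ.+ + 0                           ≡⟨ ℤₚ.+-identityʳ _ ⟩
  f (suc n)                                   ∎
  where open ≡-Reasoning

⊛-identityʳ : ∀ f → f ⊛ one ≗ f
⊛-identityʳ f n = trans (⊛-comm f one n) (⊛-identityˡ f n)

⊛-mono-suc : ∀ e f n → (mono (suc e) ⊛ f) (suc n) ≡ (mono e ⊛ f) n
⊛-mono-suc e f n = trans (⊛-head (mono (suc e)) f n) (ℤₚ.+-identityˡ _)

⊛-mono-< : ∀ e f n → n < e → (mono e ⊛ f) n ≡ + 0
⊛-mono-< (suc e) f zero    _         = refl
⊛-mono-< (suc e) f (suc n) (s≤s n<e) = trans (⊛-mono-suc e f n) (⊛-mono-< e f n n<e)

⊛-mono-mono : ∀ d e → mono d ⊛ mono e ≗ mono (d + e)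
⊛-mono-mono zero    e n       = ⊛-identityˡ (mono e) n
⊛-mono-mono (suc d) e zero    = refl
⊛-mono-mono (suc d) e (suc n) = trans (⊛-mono-suc d (mono e) n) (⊛-mono-mono d e n)

⊝-⊕ : ∀ f g → f ⊝ g ≗ f ⊕ (-[1+ 0 ] • g)
⊝-⊕ f g n = cong (λ z → f n ℤ.+ z) (sym (ℤₚ.-1*i≡-i (g n)))

⊛-distribʳ-⊝ : ∀ f g h → (f ⊝ g) ⊛ h ≗ (f ⊛ h) ⊝ (g ⊛ h)
⊛-distribʳ-⊝ f g h n = begin
  ((f ⊝ g) ⊛ h) n                             ≡⟨ ⊛-congʳ h (⊝-⊕ f g) n ⟩
  ((f ⊕ (-[1+ 0 ] • g)) ⊛ h) n                ≡⟨ ⊛-distribʳ f (-[1+ 0 ] • g) h n ⟩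
  (f ⊛ h) n ℤ.+ ((-[1+ 0 ] • g) ⊛ h) n        ≡⟨ cong (λ z → (f ⊛ h) n ℤ.+ z) (⊛-•ˡ -[1+ 0 ] g h n) ⟩
  ((f ⊛ h) ⊕ (-[1+ 0 ] • (g ⊛ h))) n          ≡⟨ ⊝-⊕ (f ⊛ h) (g ⊛ h) n ⟨
  ((f ⊛ h) ⊝ (g ⊛ h)) n                       ∎
  where open ≡-Reasoning

⊛-one⊝-< : ∀ e f n → n < e → ((one ⊝ mono e) ⊛ f) n ≡ f n
⊛-one⊝-< e f n n<e = begin
  ((one ⊝ mono e) ⊛ f) n             ≡⟨ ⊛-distribʳ-⊝ one (mono e) f n ⟩
  (one ⊛ f) n ℤ.- (mono e ⊛ f) n     ≡⟨ cong₂ ℤ._-_ (⊛-identityˡ f n) (⊛-mono-< e f n n<e) ⟩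
  f n ℤ.- + 0                        ≡⟨ ℤₚ.+-identityʳ _ ⟩
  f n                                ∎
  where open ≡-Reasoning

⊛-commutativeMonoid : CommutativeMonoid _ _
⊛-commutativeMonoid = record
  { Carrier = PS
  ; _≈_ = _≗_
  ; _∙_ = _⊛_
  ; ε = one
  ; isCommutativeMonoid = record
    { isMonoid = record
      { isSemigroup = record
        { isMagma = record
          { isEquivalence = Setoid.isEquivalence (ℕ →-setoid ℤ)
          ; ∙-cong = λ {f} {f′} {g} {g′} → ⊛-cong {f} {f′} {g} {g′}
          }
        ; assoc = ⊛-assoc
        }
      ; identity = ⊛-identityˡ , ⊛-identityʳ
      }
    ; comm = ⊛-comm
    }
  }

⊛-cancelˡ : ∀ f g h → f 0 ≡ + 1 → f ⊛ g ≗ f ⊛ h → g ≗ h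
⊛-cancelˡ f g h f₀ eq n = go n n ℕₚ.≤-refl
  where
  expand : ∀ (u : PS) m → (f ⊛ u) (suc m) ≡ u (suc m) ℤ.+ (tail f ⊛ u) m
  expand u m = trans (⊛-head f u m)
    (cong (ℤ._+ (tail f ⊛ u) m) (trans (cong (ℤ._* u (suc m)) f₀) (ℤₚ.*-identityˡ _)))
  base : ∀ (u : PS) → (f ⊛ u) 0 ≡ u 0
  base u = trans (ℤₚ.+-identityˡ _) (trans (cong (ℤ._* u 0) f₀) (ℤₚ.*-identityˡ _))
  -- The bound `N` makes the induction strong: the coefficient at `suc m` involves all those up to
  -- `m`.
  go : ∀ N m → m ≤ N → g m ≡ h m
  go N       zero    _         = trans (sym (base g)) (trans (eq 0) (base h))
  go (suc N) (suc m) (s≤s m≤N) = ∙-cancelʳ (AbelianGroup.group ℤₚ.+-0-abelianGroup) ((tail f ⊛ g) m) (g (suc m)) (h (suc m)) (begin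
    g (suc m) ℤ.+ (tail f ⊛ g) m    ≡⟨ expand g m ⟨
    (f ⊛ g) (suc m)                 ≡⟨ eq (suc m) ⟩
    (f ⊛ h) (suc m)                 ≡⟨ expand h m ⟩
    h (suc m) ℤ.+ (tail f ⊛ h) m    ≡⟨ cong (λ z → h (suc m) ℤ.+ z)
      (⊛-cong≤ m {tail f} {tail f} (λ _ _ → refl) (λ i i≤m → go N i (ℕₚ.≤-trans i≤m m≤N))) ⟨
    h (suc m) ℤ.+ (tail f ⊛ g) m    ∎)
    where open ≡-Reasoning

-- Locally finite sums of power series

private variable
  I J : Set

Σᴸ : List I → (I → ℤ) → ℤ
Σᴸ []       g = + 0
Σᴸ (i ∷ is) g = g i ℤ.+ Σᴸ is g

Σᴸ-cong : ∀ (is : List I) {g h : I → ℤ} → (∀ i → g i ≡ h i) → Σᴸ is g ≡ Σᴸ is h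
Σᴸ-cong []       eq = refl
Σᴸ-cong (i ∷ is) eq = cong₂ ℤ._+_ (eq i) (Σᴸ-cong is eq)

Σᴸ-zero : ∀ (is : List I) → Σᴸ is (λ _ → + 0) ≡ + 0
Σᴸ-zero []       = refl
Σᴸ-zero (i ∷ is) = trans (ℤₚ.+-identityˡ _) (Σᴸ-zero is)

Σᴸ-+ : ∀ (is : List I) g h → Σᴸ is (λ i → g i ℤ.+ h i) ≡ Σᴸ is g ℤ.+ Σᴸ is h
Σᴸ-+ []       g h = refl
Σᴸ-+ (i ∷ is) g h = trans (cong (λ z → (g i ℤ.+ h i) ℤ.+ z) (Σᴸ-+ is g h))
                          (interchange (g i) (h i) (Σᴸ is g) (Σᴸ is h))
  where
  interchange : ∀ a b c d → (a ℤ.+ b) ℤ.+ (c ℤ.+ d) ≡ (a ℤ.+ c) ℤ.+ (b ℤ.+ d)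
  interchange = solve-∀

Σᴸ-*ˡ : ∀ (is : List I) c g → Σᴸ is (λ i → c ℤ.* g i) ≡ c ℤ.* Σᴸ is g
Σᴸ-*ˡ []       c g = sym (ℤₚ.*-zeroʳ c)
Σᴸ-*ˡ (i ∷ is) c g = trans (cong (λ z → c ℤ.* g i ℤ.+ z) (Σᴸ-*ˡ is c g))
                           (sym (ℤₚ.*-distribˡ-+ c (g i) _))

Σᴸ-map : ∀ (φ : I → J) is g → Σᴸ (map φ is) g ≡ Σᴸ is (g ∘ φ)
Σᴸ-map φ []       g = refl
Σᴸ-map φ (i ∷ is) g = cong (λ z → g (φ i) ℤ.+ z) (Σᴸ-map φ is g)

Σᴸ-++ : ∀ (is js : List I) g → Σᴸ (is ++ js) g ≡ Σᴸ is g ℤ.+ Σᴸ js g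
Σᴸ-++ []       js g = sym (ℤₚ.+-identityˡ _)
Σᴸ-++ (i ∷ is) js g = trans (cong (λ z → g i ℤ.+ z) (Σᴸ-++ is js g)) (sym (ℤₚ.+-assoc (g i) _ _))

Σᴸ-swap : ∀ (is : List I) (js : List J) (g : I → J → ℤ) →
          Σᴸ is (λ i → Σᴸ js (g i)) ≡ Σᴸ js (λ j → Σᴸ is (λ i → g i j))
Σᴸ-swap []       js g = sym (Σᴸ-zero js)
Σᴸ-swap (i ∷ is) js g = trans (cong (λ z → Σᴸ js (g i) ℤ.+ z) (Σᴸ-swap is js g))
                              (sym (Σᴸ-+ js (g i) _))

Σᴸ-cartesianProduct : ∀ (is : List I) (js : List J) g →
  Σᴸ (cartesianProduct is js) g ≡ Σᴸ is (λ i → Σᴸ js (λ j → g (i , j)))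
Σᴸ-cartesianProduct []       js g = refl
Σᴸ-cartesianProduct (i ∷ is) js g = trans (Σᴸ-++ (map (i ,_) js) _ g)
  (cong₂ ℤ._+_ (Σᴸ-map (i ,_) js g) (Σᴸ-cartesianProduct is js g))

Σᴾ : List I → (I → PS) → PS
Σᴾ is F n = Σᴸ is (λ i → F i n)

Σᴾ-⊛ˡ : ∀ (is : List I) (h : PS) (F : I → PS) → Σᴾ is (λ i → h ⊛ F i) ≗ h ⊛ Σᴾ is F
Σᴾ-⊛ˡ []       h F n = sym (⊛-zeroʳ h n)
Σᴾ-⊛ˡ (i ∷ is) h F n = trans (cong (λ z → (h ⊛ F i) n ℤ.+ z) (Σᴾ-⊛ˡ is h F n))
                             (sym (⊛-distribˡ h (F i) (Σᴾ is F) n))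

Σᴾ-⊛ʳ : ∀ (is : List I) (F : I → PS) (h : PS) → Σᴾ is (λ i → F i ⊛ h) ≗ Σᴾ is F ⊛ h
Σᴾ-⊛ʳ is F h n = trans (Σᴸ-cong is (λ i → ⊛-comm (F i) h n))
  (trans (Σᴾ-⊛ˡ is h F n) (⊛-comm h (Σᴾ is F) n))

module _ (_≟_ : DecidableEquality I) where

  private
    at : I → (I → ℤ) → I → ℤ
    at i g j = if does (i ≟ j) then g i else + 0

    at-≢ : ∀ i g js → All (i ≢_) js → Σᴸ js (at i g) ≡ + 0
    at-≢ i g []       []          = refl
    at-≢ i g (j ∷ js) (i≢j ∷ i∉js) with i ≟ j
    ... | yes i≡j = contradiction i≡j i≢j
    ... | no  _   = trans (ℤₚ.+-identityˡ _) (at-≢ i g js i∉js)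

    at-∈ : ∀ i g js → Unique js → i ∈ js → Σᴸ js (at i g) ≡ g i
    at-∈ i g (j ∷ js) (j∉js ∷ u) i∈ with i ≟ j
    at-∈ i g (j ∷ js) (j∉js ∷ u) i∈         | yes refl =
      trans (cong (λ z → g i ℤ.+ z) (at-≢ i g js j∉js)) (ℤₚ.+-identityʳ _)
    at-∈ i g (j ∷ js) (j∉js ∷ u) (here i≡j) | no i≢j = contradiction i≡j i≢j
    at-∈ i g (j ∷ js) (j∉js ∷ u) (there i∈) | no i≢j =
      trans (ℤₚ.+-identityˡ _) (at-∈ i g js u i∈)

    at-zero : ∀ i g js → g i ≡ + 0 → Σᴸ js (at i g) ≡ + 0
    at-zero i g []       eq = refl
    at-zero i g (j ∷ js) eq with i ≟ j
    ... | yes _ = trans (cong₂ ℤ._+_ eq (at-zero i g js eq)) refl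
    ... | no  _ = trans (ℤₚ.+-identityˡ _) (at-zero i g js eq)

    at-covers : ∀ i g js → Unique js → i ∈ js ⊎ g i ≡ + 0 → Σᴸ js (at i g) ≡ g i
    at-covers i g js u (inj₁ i∈js) = at-∈ i g js u i∈js
    at-covers i g js u (inj₂ gi≡0) = trans (at-zero i g js gi≡0) (sym gi≡0)

    at-sym : ∀ g i j → at i g j ≡ at j g i
    at-sym g i j with i ≟ j | j ≟ i
    ... | yes refl | yes _   = refl
    ... | yes i≡j  | no  j≢i = contradiction (sym i≡j) j≢i
    ... | no  i≢j  | yes j≡i = contradiction (sym j≡i) i≢j
    ... | no  _    | no  _   = refl

  -- Each `g i` is the sum of `at i g` over the other list, whether i occurs there or `g i` is zero.
  -- Exchanging the two summations lets the lists trade places.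
  Σᴸ-support : ∀ {is js : List I} (g : I → ℤ) → Unique is → Unique js →
               (∀ i → i ∈ is ⊎ g i ≡ + 0) → (∀ i → i ∈ js ⊎ g i ≡ + 0) →
               Σᴸ is g ≡ Σᴸ js g
  Σᴸ-support {is} {js} g u v p q = begin
    Σᴸ is g                               ≡⟨ Σᴸ-cong is (λ i → at-covers i g js v (q i)) ⟨
    Σᴸ is (λ i → Σᴸ js (at i g))          ≡⟨ Σᴸ-swap is js (λ i → at i g) ⟩
    Σᴸ js (λ j → Σᴸ is (λ i → at i g j))  ≡⟨ Σᴸ-cong js (λ j → Σᴸ-cong is (λ i → at-sym g i j)) ⟩
    Σᴸ js (λ j → Σᴸ is (at j g))          ≡⟨ Σᴸ-cong js (λ j → at-covers j g is u (p j)) ⟩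
    Σᴸ js g                               ∎
    where open ≡-Reasoning

-- Σ_i F i = s, where the sum is locally finite: for each N one finite index set
-- accounts for all the coefficients up to N.
record IsSum {I : Set} (F : I → PS) (s : PS) : Set where
  field
    support : ℕ → List I
    unique  : ∀ N → Unique (support N)
    covers  : ∀ N i n → n ≤ N → i ∈ support N ⊎ F i n ≡ + 0
    total   : ∀ N n → n ≤ N → Σᴸ (support N) (λ i → F i n) ≡ s n

open IsSum

isSum-unique : DecidableEquality I → ∀ {F : I → PS} {s t} → IsSum F s → IsSum F t → s ≗ t
isSum-unique _≟_ {F} p q n = trans (sym (total p n n ℕₚ.≤-refl))
  (trans (Σᴸ-support _≟_ (λ i → F i n) (unique p n) (unique q n)
           (λ i → covers p n i n ℕₚ.≤-refl) (λ i → covers q n i n ℕₚ.≤-refl))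
         (total q n n ℕₚ.≤-refl))

-- The sum is defined diagonally, its coefficient at N being read off from the N-th list. By
-- `Σᴸ-support` every list that covers this degree gives the same coefficient.
isSum-exists : DecidableEquality I → ∀ {F : I → PS} (is : ℕ → List I) →
  (∀ N → Unique (is N)) → (∀ N i n → n ≤ N → i ∈ is N ⊎ F i n ≡ + 0) →
  IsSum F (λ N → Σᴸ (is N) (λ i → F i N))
isSum-exists _≟_ {F} is u c = record
  { support = is
  ; unique  = u
  ; covers  = c
  ; total   = λ N n n≤N → Σᴸ-support _≟_ (λ i → F i n) (u N) (u n)
                (λ i → c N i n n≤N) (λ i → c n i n ℕₚ.≤-refl)
  }

isSum-cong : ∀ {F G : I → PS} {s t} → (∀ i → F i ≗ G i) → s ≗ t → IsSum F s → IsSum G t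
isSum-cong F≗G s≗t p = record
  { support = support p
  ; unique  = unique p
  ; covers  = λ N i n n≤N → Sum.map₂ (trans (sym (F≗G i n))) (covers p N i n n≤N)
  ; total   = λ N n n≤N → trans (Σᴸ-cong (support p N) (λ i → sym (F≗G i n)))
                                (trans (total p N n n≤N) (s≗t n))
  }

-- Stage `l N` is exact up to degree N, in the terms as well as in the value. In the triple product
-- the stage is the number of factors.
isSum-limit : ∀ {F : ℕ → I → PS} {s : ℕ → PS} {G t} (l : ℕ → ℕ) →
  (∀ N i n → n ≤ N → F (l N) i n ≡ G i n) → (∀ N n → n ≤ N → s (l N) n ≡ t n) →
  (∀ m → IsSum (F m) (s m)) → IsSum G t
isSum-limit l F→G s→t p = record
  { support = λ N → support (p (l N)) N
  ; unique  = λ N → unique (p (l N)) N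
  ; covers  = λ N i n n≤N → Sum.map₂ (trans (sym (F→G N i n n≤N))) (covers (p (l N)) N i n n≤N)
  ; total   = λ N n n≤N → trans (Σᴸ-cong (support (p (l N)) N) (λ i → sym (F→G N i n n≤N)))
                                (trans (total (p (l N)) N n n≤N) (s→t N n n≤N))
  }

isSum-reindex : ∀ {F : I → PS} {s} (φ : J → I) (ψ : I → J) →
  (∀ i → φ (ψ i) ≡ i) → (∀ j → ψ (φ j) ≡ j) → IsSum F s → IsSum (F ∘ φ) s
isSum-reindex {F = F} φ ψ φψ ψφ p = record
  { support = λ N → map ψ (support p N)
  ; unique  = λ N → Unique.map⁺ (λ {i} {j} eq → trans (sym (φψ i)) (trans (cong φ eq) (φψ j)))
                                (unique p N)
  ; covers  = λ N j n n≤N → Sum.map₁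
                (λ φj∈ → subst (_∈ map ψ (support p N)) (ψφ j) (∈.∈-map⁺ ψ φj∈))
                (covers p N (φ j) n n≤N)
  ; total   = λ N n n≤N → trans (Σᴸ-map ψ (support p N) _)
                (trans (Σᴸ-cong (support p N) (λ i → cong (λ i′ → F i′ n) (φψ i))) (total p N n n≤N))
  }

isSum-extend : ∀ {F : I → PS} {G : J → PS} {s} (φ : I → J) → (∀ {i j} → φ i ≡ φ j → i ≡ j) →
  (∀ i → G (φ i) ≗ F i) → (∀ j → (∃ λ i → φ i ≡ j) ⊎ (G j ≗ 𝟘)) → IsSum F s → IsSum G s
isSum-extend {F = F} {G} φ φ-inj Gφ split p = record
  { support = λ N → map φ (support p N)
  ; unique  = λ N → Unique.map⁺ φ-inj (unique p N)
  ; covers  = λ N j n n≤N → cover N j n n≤N (split j)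
  ; total   = λ N n n≤N → trans (Σᴸ-map φ (support p N) _)
                (trans (Σᴸ-cong (support p N) (λ i → Gφ i n)) (total p N n n≤N))
  }
  where
  cover : ∀ N j n → n ≤ N → (∃ λ i → φ i ≡ j) ⊎ (G j ≗ 𝟘) → j ∈ map φ (support p N) ⊎ G j n ≡ + 0
  cover N j n n≤N (inj₂ Gj≡0)      = inj₂ (Gj≡0 n)
  cover N j n n≤N (inj₁ (i , refl)) =
    Sum.map (∈.∈-map⁺ φ) (trans (Gφ i n)) (covers p N i n n≤N)

isSum-• : ∀ {F : I → PS} {s} c → IsSum F s → IsSum (λ i → c • F i) (c • s)
isSum-• {F = F} c p = record
  { support = support p
  ; unique  = unique p
  ; covers  = λ N i n n≤N → Sum.map₂ (λ eq → trans (cong (c ℤ.*_) eq) (ℤₚ.*-zeroʳ c))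
                                          (covers p N i n n≤N)
  ; total   = λ N n n≤N → trans (Σᴸ-*ˡ (support p N) c (λ i → F i n)) (cong (c ℤ.*_) (total p N n n≤N))
  }

isSum-+ : DecidableEquality I → ∀ {F G : I → PS} {s t} →
  IsSum F s → IsSum G t → IsSum (λ i → F i ⊕ G i) (s ⊕ t)
isSum-+ _≟_ {F} {G} p q = record
  { support = both
  ; unique  = λ N → deduplicate-! _≟_ _
  ; covers  = cover
  ; total   = λ N n n≤N → trans (Σᴸ-+ (both N) (λ i → F i n) (λ i → G i n)) (cong₂ ℤ._+_
      (trans (Σᴸ-support _≟_ (λ i → F i n) (deduplicate-! _≟_ _) (unique p N)
               (λ i → Sum.map₁ (left N) (covers p N i n n≤N)) (λ i → covers p N i n n≤N))
             (total p N n n≤N))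
      (trans (Σᴸ-support _≟_ (λ i → G i n) (deduplicate-! _≟_ _) (unique q N)
               (λ i → Sum.map₁ (right N) (covers q N i n n≤N)) (λ i → covers q N i n n≤N))
             (total q N n n≤N)))
  }
  where
  both : ℕ → List _
  both N = deduplicate _≟_ (support p N ++ support q N)
  left : ∀ N {i} → i ∈ support p N → i ∈ both N
  left N i∈ = ∈.∈-deduplicate⁺ _≟_ (∈.∈-++⁺ˡ i∈)
  right : ∀ N {i} → i ∈ support q N → i ∈ both N
  right N i∈ = ∈.∈-deduplicate⁺ _≟_ (∈.∈-++⁺ʳ (support p N) i∈)
  cover : ∀ N i n → n ≤ N → i ∈ both N ⊎ (F i ⊕ G i) n ≡ + 0
  cover N i n n≤N with covers p N i n n≤N | covers q N i n n≤N
  ... | inj₁ i∈ | _       = inj₁ (left N i∈)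
  ... | inj₂ _  | inj₁ i∈ = inj₁ (right N i∈)
  ... | inj₂ x  | inj₂ y  = inj₂ (cong₂ ℤ._+_ x y)

isSum-⊛ : ∀ {F : I → PS} {G : J → PS} {s t} → IsSum F s → IsSum G t →
          IsSum (λ (i , j) → F i ⊛ G j) (s ⊛ t)
isSum-⊛ {F = F} {G} {s} {t} p q = record
  { support = λ N → cartesianProduct (support p N) (support q N)
  ; unique  = λ N → Unique.cartesianProduct⁺ (unique p N) (unique q N)
  ; covers  = cover
  ; total   = λ N n n≤N → begin
      Σᴸ (cartesianProduct (support p N) (support q N)) (λ (i , j) → (F i ⊛ G j) n)
        ≡⟨ Σᴸ-cartesianProduct (support p N) (support q N) _ ⟩
      Σᴸ (support p N) (λ i → Σᴸ (support q N) (λ j → (F i ⊛ G j) n))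
        ≡⟨ Σᴸ-cong (support p N) (λ i → Σᴾ-⊛ˡ (support q N) (F i) G n) ⟩
      Σᴸ (support p N) (λ i → (F i ⊛ Σᴾ (support q N) G) n)
        ≡⟨ Σᴾ-⊛ʳ (support p N) F (Σᴾ (support q N) G) n ⟩
      (Σᴾ (support p N) F ⊛ Σᴾ (support q N) G) n
        ≡⟨ ⊛-cong≤ n (λ m m≤n → total p N m (ℕₚ.≤-trans m≤n n≤N))
                     (λ m m≤n → total q N m (ℕₚ.≤-trans m≤n n≤N)) ⟩
      (s ⊛ t) n ∎
  }
  where
  open ≡-Reasoning
  -- `covers` speaks of one degree at a time, but a coefficient of a product involves all lower
  -- degrees: either some degree puts the index into the support, or all the coefficients up to n
  -- vanish.
  decide : ∀ {A : Set} {P : ℕ → Set} n → (∀ m → m ≤ n → A ⊎ P m) → A ⊎ (∀ m → m ≤ n → P m)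
  decide zero    f = Sum.map₂ (λ P0 → λ { zero _ → P0 }) (f 0 z≤n)
  decide {P = P} (suc n) f with decide {P = P} n (λ m m≤n → f m (ℕₚ.m≤n⇒m≤1+n m≤n)) | f (suc n) ℕₚ.≤-refl
  ... | inj₁ a | _      = inj₁ a
  ... | inj₂ _ | inj₁ a = inj₁ a
  ... | inj₂ g | inj₂ x = inj₂ below
    where
    below : ∀ m → m ≤ suc n → P m
    below m m≤1+n with ℕₚ.m≤n⇒m<n∨m≡n m≤1+n
    ... | inj₁ m<1+n = g m (ℕₚ.≤-pred m<1+n)
    ... | inj₂ refl  = x
  cover : ∀ N ij n → n ≤ N → ij ∈ cartesianProduct (support p N) (support q N) ⊎
          (F (proj₁ ij) ⊛ G (proj₂ ij)) n ≡ + 0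
  cover N (i , j) n n≤N
    with decide {P = λ m → F i m ≡ + 0} n (λ m m≤n → covers p N i m (ℕₚ.≤-trans m≤n n≤N))
       | decide {P = λ m → G j m ≡ + 0} n (λ m m≤n → covers q N j m (ℕₚ.≤-trans m≤n n≤N))
  ... | inj₁ i∈ | inj₁ j∈ = inj₁ (∈.∈-cartesianProduct⁺ i∈ j∈)
  ... | inj₂ Fi | _       = inj₂ (trans (⊛-cong≤ n {g = G j} Fi (λ _ _ → refl)) (⊛-zeroˡ (G j) n))
  ... | inj₁ _  | inj₂ Gj = inj₂ (trans (⊛-comm (F i) (G j) n)
                              (trans (⊛-cong≤ n {g = F i} Gj (λ _ _ → refl)) (⊛-zeroˡ (F i) n)))

isSum-⊛ˡ : ∀ {F : I → PS} {s} h → IsSum F s → IsSum (λ i → h ⊛ F i) (h ⊛ s)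
isSum-⊛ˡ {F = F} {s} h p = isSum-reindex (tt ,_) proj₂ (λ _ → refl) (λ _ → refl) (isSum-⊛ single p)
  where
  single : IsSum {⊤} (λ _ → h) h
  single = record
    { support = λ _ → tt ∷ []
    ; unique  = λ _ → [] ∷ []
    ; covers  = λ _ _ _ _ → inj₁ (here refl)
    ; total   = λ _ n _ → ℤₚ.+-identityʳ (h n)
    }

lefts : List (I ⊎ J) → List I
lefts []            = []
lefts (inj₁ i ∷ xs) = i ∷ lefts xs
lefts (inj₂ j ∷ xs) = lefts xs

rights : List (I ⊎ J) → List J
rights []            = []
rights (inj₁ i ∷ xs) = rights xs
rights (inj₂ j ∷ xs) = j ∷ rights xs

∈-lefts : ∀ {i} (xs : List (I ⊎ J)) → inj₁ i ∈ xs → i ∈ lefts xs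
∈-lefts (inj₁ i ∷ xs) (here refl) = here refl
∈-lefts (inj₁ i ∷ xs) (there i∈)  = there (∈-lefts xs i∈)
∈-lefts (inj₂ j ∷ xs) (there i∈)  = ∈-lefts xs i∈

∈-rights : ∀ {j} (xs : List (I ⊎ J)) → inj₂ j ∈ xs → j ∈ rights xs
∈-rights (inj₁ i ∷ xs) (there j∈)  = ∈-rights xs j∈
∈-rights (inj₂ j ∷ xs) (here refl) = here refl
∈-rights (inj₂ j ∷ xs) (there j∈)  = there (∈-rights xs j∈)

lefts-unique : ∀ (xs : List (I ⊎ J)) → Unique xs → Unique (lefts xs)
lefts-unique []            []       = []
lefts-unique (inj₂ j ∷ xs) (_ ∷ u)  = lefts-unique xs u
lefts-unique (inj₁ i ∷ xs) (i∉ ∷ u) = go xs i∉ ∷ lefts-unique xs u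
  where
  go : ∀ xs → All (inj₁ i ≢_) xs → All (i ≢_) (lefts xs)
  go []             []        = []
  go (inj₁ i′ ∷ xs) (ne ∷ al) = (ne ∘ cong inj₁) ∷ go xs al
  go (inj₂ j ∷ xs)  (_ ∷ al)  = go xs al

rights-unique : ∀ (xs : List (I ⊎ J)) → Unique xs → Unique (rights xs)
rights-unique []            []       = []
rights-unique (inj₁ i ∷ xs) (_ ∷ u)  = rights-unique xs u
rights-unique (inj₂ j ∷ xs) (j∉ ∷ u) = go xs j∉ ∷ rights-unique xs u
  where
  go : ∀ xs → All (inj₂ j ≢_) xs → All (j ≢_) (rights xs)
  go []             []        = []
  go (inj₁ i ∷ xs)  (_ ∷ al)  = go xs al
  go (inj₂ j′ ∷ xs) (ne ∷ al) = (ne ∘ cong inj₂) ∷ go xs al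

Σᴸ-lefts-rights : ∀ (xs : List (I ⊎ J)) g →
  Σᴸ xs g ≡ Σᴸ (lefts xs) (g ∘ inj₁) ℤ.+ Σᴸ (rights xs) (g ∘ inj₂)
Σᴸ-lefts-rights []            g = refl
Σᴸ-lefts-rights (inj₁ i ∷ xs) g = trans (cong (λ z → g (inj₁ i) ℤ.+ z) (Σᴸ-lefts-rights xs g))
  (sym (ℤₚ.+-assoc (g (inj₁ i)) _ _))
Σᴸ-lefts-rights (inj₂ j ∷ xs) g = trans (cong (λ z → g (inj₂ j) ℤ.+ z) (Σᴸ-lefts-rights xs g))
  (shuffle (g (inj₂ j)) (Σᴸ (lefts xs) (g ∘ inj₁)) (Σᴸ (rights xs) (g ∘ inj₂)))
  where
  shuffle : ∀ a b c → a ℤ.+ (b ℤ.+ c) ≡ b ℤ.+ (a ℤ.+ c)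
  shuffle = solve-∀

isSum-⊎ : DecidableEquality I → DecidableEquality J → ∀ {F : I ⊎ J → PS} {s} → IsSum F s →
  ∃ λ t → ∃ λ u → IsSum (F ∘ inj₁) t × IsSum (F ∘ inj₂) u × (s ≗ t ⊕ u)
isSum-⊎ _≟₁_ _≟₂_ {F} p =
  _ , _ ,
  isSum-exists _≟₁_ (lefts ∘ support p) (λ N → lefts-unique _ (unique p N))
    (λ N i n n≤N → Sum.map₁ (∈-lefts _) (covers p N (inj₁ i) n n≤N)) ,
  isSum-exists _≟₂_ (rights ∘ support p) (λ N → rights-unique _ (unique p N))
    (λ N j n n≤N → Sum.map₁ (∈-rights _) (covers p N (inj₂ j) n n≤N)) ,
  λ n → trans (sym (total p n n ℕₚ.≤-refl)) (Σᴸ-lefts-rights (support p n) (λ x → F x n))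

-- Pochhammer products and the Jacobi triple product

factor : ℕ → ℕ → ℕ → PS
factor r k i = one ⊝ mono (r + k * i)

⊛-one⊝-<ʳ : ∀ e f n → n < e → (f ⊛ (one ⊝ mono e)) n ≡ f n
⊛-one⊝-<ʳ e f n n<e = trans (⊛-comm f (one ⊝ mono e) n) (⊛-one⊝-< e f n n<e)

finprod-cong : ∀ {F G : ℕ → PS} → (∀ i → F i ≗ G i) → ∀ m → finprod F m ≗ finprod G m
finprod-cong         F≗G zero    n = refl
finprod-cong {F} {G} F≗G (suc m) n =
  ⊛-cong {finprod F m} {finprod G m} {F m} {G m} (finprod-cong F≗G m) (F≗G m) n

finprod-head : ∀ F m → finprod F (suc m) ≗ F 0 ⊛ finprod (F ∘ suc) m
finprod-head F zero    n = ⊛-comm one (F 0) n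
finprod-head F (suc m) n = begin
  (finprod F (suc m) ⊛ F (suc m)) n                     ≡⟨ ⊛-congʳ (F (suc m)) (finprod-head F m) n ⟩
  ((F 0 ⊛ finprod (F ∘ suc) m) ⊛ F (suc m)) n           ≡⟨ ⊛-assoc (F 0) (finprod (F ∘ suc) m) (F (suc m)) n ⟩
  (F 0 ⊛ (finprod (F ∘ suc) m ⊛ F (suc m))) n           ∎
  where open ≡-Reasoning

m≤r+k*m : ∀ r k m → 1 ≤ k → m ≤ r + k * m
m≤r+k*m r k m 1≤k = ℕₚ.≤-trans (subst (_≤ k * m) (ℕₚ.*-identityˡ m) (ℕₚ.*-monoˡ-≤ m 1≤k)) (ℕₚ.m≤n+m (k * m) r)

finprod-stable : ∀ r k → 1 ≤ k → ∀ n m → n < m → finprod (factor r k) m n ≡ poch r k n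
finprod-stable r k 1≤k n (suc m) n<1+m with ℕₚ.m≤n⇒m<n∨m≡n (ℕₚ.≤-pred n<1+m)
... | inj₂ refl = refl
... | inj₁ n<m  = trans
  (⊛-one⊝-<ʳ (r + k * m) (finprod (factor r k) m) n (ℕₚ.<-≤-trans n<m (m≤r+k*m r k m 1≤k)))
  (finprod-stable r k 1≤k n m n<m)

poch-step : ∀ r k → 1 ≤ k → poch r k ≗ (one ⊝ mono r) ⊛ poch (r + k) k
poch-step r k 1≤k n = begin
  poch r k n
    ≡⟨ finprod-stable r k 1≤k n (suc (suc n)) (ℕₚ.n≤1+n (suc n)) ⟨
  finprod (factor r k) (suc (suc n)) n
    ≡⟨ finprod-head (factor r k) (suc n) n ⟩
  (factor r k 0 ⊛ finprod (factor r k ∘ suc) (suc n)) n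
    ≡⟨ ⊛-cong≤ n
         (λ i _ → cong (λ e → (one ⊝ mono e) i) (trans (cong (_+_ r) (ℕₚ.*-zeroʳ k)) (ℕₚ.+-identityʳ r)))
         (λ i i≤n → trans (finprod-cong shift (suc n) i) (finprod-stable (r + k) k 1≤k i (suc n) (s≤s i≤n))) ⟩
  ((one ⊝ mono r) ⊛ poch (r + k) k) n ∎
  where
  open ≡-Reasoning
  shift : ∀ i → factor r k (suc i) ≗ factor (r + k) k i
  shift i m = cong (λ e → (one ⊝ mono e) m) (trans (cong (_+_ r) (ℕₚ.*-suc k i)) (sym (ℕₚ.+-assoc r k (k * i))))

poch-low : ∀ r k n → n < r → poch r k n ≡ one n
poch-low r k n n<r = go (suc n)
  where
  go : ∀ m → finprod (factor r k) m n ≡ one n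
  go zero    = refl
  go (suc m) = trans (⊛-one⊝-<ʳ (r + k * m) (finprod (factor r k) m) n (ℕₚ.<-≤-trans n<r (ℕₚ.m≤m+n r (k * m)))) (go m)

-- E is the limit of A r as r → ∞.
poch-family : ∀ k → 1 ≤ k → (A : ℕ → PS) (E : PS) →
  (∀ r → 1 ≤ r → A r ≗ (one ⊝ mono r) ⊛ A (r + k)) →
  (∀ r n → 1 ≤ r → n < r → A r n ≡ E n) →
  ∀ r → 1 ≤ r → A r ≗ poch r k ⊛ E
poch-family k 1≤k A E step low r 1≤r n = begin
  A r n
    ≡⟨ unroll (suc n) n ⟩
  (finprod (factor r k) (suc n) ⊛ A (r + k * suc n)) n
    ≡⟨ ⊛-cong≤ n (λ i i≤n → finprod-stable r k 1≤k i (suc n) (s≤s i≤n))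
                 (λ i i≤n → low _ i (large (suc n)) (ℕₚ.<-≤-trans (s≤s i≤n) (m≤r+k*m r k (suc n) 1≤k))) ⟩
  (poch r k ⊛ E) n ∎
  where
  open ≡-Reasoning
  large : ∀ m → 1 ≤ r + k * m
  large m = ℕₚ.≤-trans 1≤r (ℕₚ.m≤m+n r (k * m))
  unroll : ∀ m → A r ≗ finprod (factor r k) m ⊛ A (r + k * m)
  unroll zero    n = trans (cong (λ x → A x n) (sym (trans (cong (_+_ r) (ℕₚ.*-zeroʳ k)) (ℕₚ.+-identityʳ r))))
                           (sym (⊛-identityˡ (A (r + k * 0)) n))
  unroll (suc m) n = begin
    A r n
      ≡⟨ unroll m n ⟩
    (finprod (factor r k) m ⊛ A (r + k * m)) n
      ≡⟨ ⊛-congˡ (finprod (factor r k) m) (step (r + k * m) (large m)) n ⟩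
    (finprod (factor r k) m ⊛ (factor r k m ⊛ A (r + k * m + k))) n
      ≡⟨ ⊛-assoc (finprod (factor r k) m) (factor r k m) (A (r + k * m + k)) n ⟨
    (finprod (factor r k) (suc m) ⊛ A (r + k * m + k)) n
      ≡⟨ cong (λ x → (finprod (factor r k) (suc m) ⊛ A x) n)
           (trans (ℕₚ.+-assoc r (k * m) k) (cong (_+_ r) (trans (ℕₚ.+-comm (k * m) k) (sym (ℕₚ.*-suc k m))))) ⟩
    (finprod (factor r k) (suc m) ⊛ A (r + k * suc m)) n ∎

ε : ℕ → ℤ
ε zero    = + 1
ε (suc n) = ℤ.- ε n

shift : (ℕ → PS) → ℕ → PS
shift F zero    = 𝟘
shift F (suc j) = F j

isSum-shift : ∀ {F s} → IsSum F s → IsSum (shift F) s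
isSum-shift = isSum-extend suc ℕₚ.suc-injective (λ _ _ → refl)
  λ { zero → inj₂ (λ _ → refl) ; (suc j) → inj₁ (j , refl) }

one⊝-⊛ : ∀ e f → (one ⊝ mono e) ⊛ f ≗ f ⊕ (-[1+ 0 ] • (mono e ⊛ f))
one⊝-⊛ e f n = trans (⊛-distribʳ-⊝ one (mono e) f n)
  (cong₂ ℤ._+_ (⊛-identityˡ f n) (sym (ℤₚ.-1*i≡-i _)))

-- Euler's expansion of (x; p)_∞ in powers of x, at p = q^k and x = q^r, multiplied by (p; p)_∞ to
-- clear the denominators (p; p)_j. Thus `C j` is (p; p)_∞ / (p; p)_j, and `pos r j` is r j + k j (j
-- - 1) / 2.
module Euler (k : ℕ) (1≤k : 1 ≤ k) where

  C : ℕ → PS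
  C j = poch (k * suc j) k

  C-step : ∀ j → C j ⊕ (mono (k * suc j) ⊛ C (suc j)) ≗ C (suc j)
  C-step j n = begin
    C j n ℤ.+ X                      ≡⟨ cong (ℤ._+ X) (poch-step (k * suc j) k 1≤k n) ⟩
    ((one ⊝ mono (k * suc j)) ⊛ poch (k * suc j + k) k) n ℤ.+ X
      ≡⟨ cong (λ r → ((one ⊝ mono (k * suc j)) ⊛ poch r k) n ℤ.+ X) next ⟩
    ((one ⊝ mono (k * suc j)) ⊛ C (suc j)) n ℤ.+ X
      ≡⟨ cong (ℤ._+ X) (one⊝-⊛ (k * suc j) (C (suc j)) n) ⟩
    (C (suc j) n ℤ.+ -[1+ 0 ] ℤ.* X) ℤ.+ X
      ≡⟨ lemma (C (suc j) n) X ⟩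
    C (suc j) n                      ∎
    where
    open ≡-Reasoning
    X = (mono (k * suc j) ⊛ C (suc j)) n
    next : k * suc j + k ≡ k * suc (suc j)
    next = trans (ℕₚ.+-comm (k * suc j) k) (sym (ℕₚ.*-suc k (suc j)))
    lemma : ∀ x y → (x ℤ.+ -[1+ 0 ] ℤ.* y) ℤ.+ y ≡ x
    lemma = solve-∀

  pos : ℕ → ℕ → ℕ
  pos r zero    = 0
  pos r (suc j) = pos r j + (r + k * j)

  pos-+k : ∀ r j → pos (r + k) j ≡ pos r j + k * j
  pos-+k r zero    = sym (ℕₚ.*-zeroʳ k)
  pos-+k r (suc j) = trans (cong (_+ (r + k + k * j)) (pos-+k r j)) (lemma (pos r j) r k j)
    where
    lemma : ∀ p r k j → p + k * j + (r + k + k * j) ≡ p + (r + k * j) + k * suc j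
    lemma = ℕ-solve-∀

  pos-suc : ∀ r j → pos r (suc j) ≡ r + pos (r + k) j
  pos-suc r j = trans (lemma (pos r j) r k j) (cong (_+_ r) (sym (pos-+k r j)))
    where
    lemma : ∀ p r k j → p + (r + k * j) ≡ r + (p + k * j)
    lemma = ℕ-solve-∀

  j≤pos : ∀ r → 1 ≤ r → ∀ j → j ≤ pos r j
  j≤pos r 1≤r zero    = z≤n
  j≤pos r 1≤r (suc j) = subst (_≤ pos r (suc j)) (ℕₚ.+-comm j 1)
    (ℕₚ.+-mono-≤ (j≤pos r 1≤r j) (ℕₚ.≤-trans 1≤r (ℕₚ.m≤m+n r (k * j))))

  r≤pos : ∀ r j → r ≤ pos r (suc j)
  r≤pos r j = ℕₚ.≤-trans (ℕₚ.m≤m+n r (k * j)) (ℕₚ.m≤n+m (r + k * j) (pos r j))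

  term : ℕ → ℕ → PS
  term r j = ε j • (mono (pos r j) ⊛ C j)

  term-low : ∀ r j n → n < pos r j → term r j n ≡ + 0
  term-low r j n n<e = trans (cong (ε j ℤ.*_) (⊛-mono-< (pos r j) (C j) n n<e)) (ℤₚ.*-zeroʳ (ε j))

  R : ℕ → PS
  R r N = Σᴸ (upTo (suc N)) (λ j → term r j N)

  R-isSum : ∀ r → 1 ≤ r → IsSum (term r) (R r)
  R-isSum r 1≤r = isSum-exists ℕₚ._≟_ (λ N → upTo (suc N)) (λ N → Unique.upTo⁺ (suc N)) cover
    where
    cover : ∀ N j n → n ≤ N → j ∈ upTo (suc N) ⊎ term r j n ≡ + 0
    cover N j n n≤N with j ℕₚ.≤? N
    ... | yes j≤N = inj₁ (∈.∈-upTo⁺ (s≤s j≤N))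
    ... | no  j≰N = inj₂ (term-low r j n
      (ℕₚ.<-≤-trans (ℕₚ.≤-<-trans n≤N (ℕₚ.≰⇒> j≰N)) (j≤pos r 1≤r j)))

  R-low : ∀ r n → 1 ≤ r → n < r → R r n ≡ C 0 n
  R-low r n 1≤r n<r = begin
    R r n                            ≡⟨ IsSum.total sum n n ℕₚ.≤-refl ⟨
    Σᴸ (IsSum.support sum n) (λ j → term r j n)
      ≡⟨ Σᴸ-support ℕₚ._≟_ (λ j → term r j n) (IsSum.unique sum n) ([] ∷ [])
           (λ j → IsSum.covers sum n j n ℕₚ.≤-refl) cover ⟩
    + 1 ℤ.* (one ⊛ C 0) n ℤ.+ + 0    ≡⟨ ℤₚ.+-identityʳ _ ⟩
    + 1 ℤ.* (one ⊛ C 0) n            ≡⟨ ℤₚ.*-identityˡ _ ⟩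
    (one ⊛ C 0) n                    ≡⟨ ⊛-identityˡ (C 0) n ⟩
    C 0 n                            ∎
    where
    open ≡-Reasoning
    sum = R-isSum r 1≤r
    cover : ∀ j → j ∈ 0 ∷ [] ⊎ term r j n ≡ + 0
    cover zero    = inj₁ (here refl)
    cover (suc j) = inj₂ (term-low r (suc j) n (ℕₚ.<-≤-trans n<r (r≤pos r j)))

  -- The functional equation R(x) = (1 - x) R(p x) of Euler's series, compared term by term. Once
  -- the common power of q is taken out, it is `C-step`.
  term-step : ∀ r j → term (r + k) j ⊕ (-[1+ 0 ] • shift (λ i → mono r ⊛ term (r + k) i) j) ≗ term r j
  term-step r zero    n = ℤₚ.+-identityʳ _
  term-step r (suc j) n = begin
    ε (suc j) ℤ.* (mono (pos (r + k) (suc j)) ⊛ C (suc j)) n ℤ.+ -[1+ 0 ] ℤ.* (mono r ⊛ term (r + k) j) n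
      ≡⟨ cong₂ (λ x y → ε (suc j) ℤ.* x ℤ.+ -[1+ 0 ] ℤ.* y) left right ⟩
    ε (suc j) ℤ.* (M ⊛ (mono (k * suc j) ⊛ C (suc j))) n ℤ.+ -[1+ 0 ] ℤ.* (ε j ℤ.* (M ⊛ C j) n)
      ≡⟨ lemma (ε j) ((M ⊛ (mono (k * suc j) ⊛ C (suc j))) n) ((M ⊛ C j) n) ⟩
    ε (suc j) ℤ.* ((M ⊛ C j) n ℤ.+ (M ⊛ (mono (k * suc j) ⊛ C (suc j))) n)
      ≡⟨ cong (ε (suc j) ℤ.*_) (⊛-distribˡ M (C j) (mono (k * suc j) ⊛ C (suc j)) n) ⟨
    ε (suc j) ℤ.* (M ⊛ (C j ⊕ (mono (k * suc j) ⊛ C (suc j)))) n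
      ≡⟨ cong (ε (suc j) ℤ.*_) (⊛-congˡ M (C-step j) n) ⟩
    term r (suc j) n ∎
    where
    open ≡-Reasoning
    M = mono (pos r (suc j))
    lemma : ∀ s x y → (ℤ.- s) ℤ.* x ℤ.+ -[1+ 0 ] ℤ.* (s ℤ.* y) ≡ (ℤ.- s) ℤ.* (y ℤ.+ x)
    lemma = solve-∀
    left : (mono (pos (r + k) (suc j)) ⊛ C (suc j)) n ≡ (M ⊛ (mono (k * suc j) ⊛ C (suc j))) n
    left = begin
      (mono (pos (r + k) (suc j)) ⊛ C (suc j)) n
        ≡⟨ cong (λ e → (mono e ⊛ C (suc j)) n) (pos-+k r (suc j)) ⟩
      (mono (pos r (suc j) + k * suc j) ⊛ C (suc j)) n
        ≡⟨ ⊛-congʳ (C (suc j)) (⊛-mono-mono (pos r (suc j)) (k * suc j)) n ⟨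
      ((M ⊛ mono (k * suc j)) ⊛ C (suc j)) n
        ≡⟨ ⊛-assoc M (mono (k * suc j)) (C (suc j)) n ⟩
      (M ⊛ (mono (k * suc j) ⊛ C (suc j))) n ∎
    right : (mono r ⊛ term (r + k) j) n ≡ ε j ℤ.* (M ⊛ C j) n
    right = begin
      (mono r ⊛ term (r + k) j) n
        ≡⟨ ⊛-•ʳ (ε j) (mono r) (mono (pos (r + k) j) ⊛ C j) n ⟩
      ε j ℤ.* (mono r ⊛ (mono (pos (r + k) j) ⊛ C j)) n
        ≡⟨ cong (ε j ℤ.*_) (⊛-assoc (mono r) (mono (pos (r + k) j)) (C j) n) ⟨
      ε j ℤ.* ((mono r ⊛ mono (pos (r + k) j)) ⊛ C j) n
        ≡⟨ cong (ε j ℤ.*_) (⊛-congʳ (C j) (⊛-mono-mono r (pos (r + k) j)) n) ⟩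
      ε j ℤ.* (mono (r + pos (r + k) j) ⊛ C j) n
        ≡⟨ cong (λ e → ε j ℤ.* (mono e ⊛ C j) n) (pos-suc r j) ⟨
      ε j ℤ.* (M ⊛ C j) n ∎

  R-step : ∀ r → 1 ≤ r → R r ≗ (one ⊝ mono r) ⊛ R (r + k)
  R-step r 1≤r = isSum-unique ℕₚ._≟_ (R-isSum r 1≤r)
    (isSum-cong (term-step r) (λ n → sym (one⊝-⊛ r (R (r + k)) n))
      (isSum-+ ℕₚ._≟_ sum (isSum-• -[1+ 0 ] (isSum-shift (isSum-⊛ˡ (mono r) sum)))))
    where
    sum = R-isSum (r + k) (ℕₚ.≤-trans 1≤r (ℕₚ.m≤m+n r k))

  euler : ∀ r → 1 ≤ r → IsSum (term r) (poch r k ⊛ C 0)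
  euler r 1≤r = isSum-cong (λ _ _ → refl)
    (poch-family k 1≤k R (C 0) R-step R-low r 1≤r) (R-isSum r 1≤r)

module Jacobi (a b : ℕ) (1≤a : 1 ≤ a) (1≤b : 1 ≤ b) where

  k : ℕ
  k = a + b

  1≤k : 1 ≤ k
  1≤k = ℕₚ.≤-trans 1≤a (ℕₚ.m≤m+n a b)

  open Euler k 1≤k

  εℤ : ℤ → ℤ
  εℤ (+ n)    = ε n
  εℤ -[1+ n ] = ε (suc n)

  exponent : ℤ → ℕ
  exponent (+ n)    = pos a n
  exponent -[1+ n ] = pos b (suc n)

  -- The usual convention that 1 / (q^k; q^k)_n is zero for negative n.
  Cℤ : ℤ → PS
  Cℤ (+ n)    = C n
  Cℤ -[1+ n ] = 𝟘

  -- Σ_j W l j = (q^a;q^k)_∞ (q^k;q^k)_∞ ∏_{i<l} (1 - q^{b+ki}); as l → ∞ the factors C tend to 1.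
  W : ℕ → ℤ → PS
  W l j = εℤ j • (mono (exponent j) ⊛ Cℤ (+ l ℤ.+ j))

  W₀-isSum : IsSum (W 0) (poch a k ⊛ C 0)
  W₀-isSum = isSum-extend +_ ℤₚ.+-injective (λ _ _ → refl)
    (λ { (+ n) → inj₁ (n , refl)
       ; -[1+ n ] → inj₂ (λ m → trans (cong (ε (suc n) ℤ.*_) (⊛-zeroʳ (mono (pos b (suc n))) m))
                                      (ℤₚ.*-zeroʳ (ε (suc n)))) })
    (euler a 1≤a)

  εℤ-suc : ∀ j → εℤ j ≡ ℤ.- εℤ (ℤ.suc j)
  εℤ-suc (+ n)          = sym (ℤₚ.neg-involutive (ε n))
  εℤ-suc -[1+ zero ]    = refl
  εℤ-suc -[1+ suc n ]   = refl

  exponent-neg : ∀ n → exponent (ℤ.suc -[1+ n ]) ≡ pos b n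
  exponent-neg zero    = refl
  exponent-neg (suc n) = refl

  -- From j to j + 1 `exponent` grows by a + k j, and (a + k j) + (b + k l) = k (l + j + 1). The
  -- case l + j + 1 < 0 is left out because `Cℤ` vanishes there.
  exponent-suc : ∀ l m j → + l ℤ.+ ℤ.suc j ≡ + m → (b + k * l) + exponent (ℤ.suc j) ≡ exponent j + k * m
  exponent-suc l m (+ n) eq with refl ← ℤₚ.+-injective eq = lemma (pos a n) a b l n
    where
    lemma : ∀ p a b l n → b + (a + b) * l + (p + (a + (a + b) * n)) ≡ p + (a + b) * (l + suc n)
    lemma = ℕ-solve-∀
  exponent-suc l m -[1+ n ] eq = begin
    b + k * l + exponent (ℤ.suc -[1+ n ])   ≡⟨ cong₂ (λ x y → b + k * x + y) l≡ (exponent-neg n) ⟩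
    b + k * (m + n) + pos b n               ≡⟨ lemma (pos b n) b k m n ⟩
    pos b n + (b + k * n) + k * m           ∎
    where
    open ≡-Reasoning
    lemma : ∀ p b k m n → b + k * (m + n) + p ≡ p + (b + k * n) + k * m
    lemma = ℕ-solve-∀
    cancel : ∀ x y → x ≡ (x ℤ.+ (+ 1 ℤ.+ ℤ.- (+ 1 ℤ.+ y))) ℤ.+ y
    cancel = solve-∀
    l≡ : l ≡ m + n
    l≡ = ℤₚ.+-injective (trans (cancel (+ l) (+ n)) (cong (ℤ._+ + n) eq))

  Cℤ-step : ∀ l j → mono (exponent j) ⊛ Cℤ (+ l ℤ.+ j) ⊕ mono (b + k * l) ⊛ (mono (exponent (ℤ.suc j)) ⊛ Cℤ (+ l ℤ.+ ℤ.suc j))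
            ≗ mono (exponent j) ⊛ Cℤ (+ l ℤ.+ ℤ.suc j)
  Cℤ-step l j n = go (+ l ℤ.+ j) (+ l ℤ.+ ℤ.suc j) (shift-suc (+ l) j) (λ m → exponent-suc l m j)
    where
    open ≡-Reasoning
    E = mono (exponent j)
    E′ = mono (exponent (ℤ.suc j))
    B = mono (b + k * l)
    shift-suc : ∀ x y → x ℤ.+ (+ 1 ℤ.+ y) ≡ + 1 ℤ.+ (x ℤ.+ y)
    shift-suc = solve-∀
    merge : ∀ m X → b + k * l + exponent (ℤ.suc j) ≡ exponent j + k * m →
            B ⊛ (E′ ⊛ X) ≗ E ⊛ (mono (k * m) ⊛ X)
    merge m X eq i = begin
      (B ⊛ (E′ ⊛ X)) i                                       ≡⟨ ⊛-assoc B E′ X i ⟨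
      ((B ⊛ E′) ⊛ X) i                                       ≡⟨ ⊛-congʳ X (⊛-mono-mono (b + k * l) (exponent (ℤ.suc j))) i ⟩
      (mono (b + k * l + exponent (ℤ.suc j)) ⊛ X) i          ≡⟨ cong (λ e → (mono e ⊛ X) i) eq ⟩
      (mono (exponent j + k * m) ⊛ X) i                      ≡⟨ ⊛-congʳ X (⊛-mono-mono (exponent j) (k * m)) i ⟨
      ((E ⊛ mono (k * m)) ⊛ X) i                             ≡⟨ ⊛-assoc E (mono (k * m)) X i ⟩
      (E ⊛ (mono (k * m) ⊛ X)) i                             ∎
    go : ∀ J J′ → J′ ≡ ℤ.suc J → (∀ m → J′ ≡ + m → b + k * l + exponent (ℤ.suc j) ≡ exponent j + k * m) →
         (E ⊛ Cℤ J ⊕ B ⊛ (E′ ⊛ Cℤ J′)) n ≡ (E ⊛ Cℤ J′) n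
    go (+ M) _ refl e = begin
      (E ⊛ C M ⊕ B ⊛ (E′ ⊛ C (suc M))) n              ≡⟨ cong (λ z → (E ⊛ C M) n ℤ.+ z) (merge (suc M) (C (suc M)) (e (suc M) refl) n) ⟩
      (E ⊛ C M ⊕ E ⊛ (mono (k * suc M) ⊛ C (suc M))) n  ≡⟨ ⊛-distribˡ E (C M) (mono (k * suc M) ⊛ C (suc M)) n ⟨
      (E ⊛ (C M ⊕ mono (k * suc M) ⊛ C (suc M))) n    ≡⟨ ⊛-congˡ E (C-step M) n ⟩
      (E ⊛ C (suc M)) n                               ∎
    -- At the edge l + j = -1 the first summand is zero, and the second one carries only the factor
    -- q^0, so it already equals the right-hand side.
    go -[1+ zero ] _ refl e = begin
      (E ⊛ 𝟘 ⊕ B ⊛ (E′ ⊛ C 0)) n       ≡⟨ cong₂ ℤ._+_ (⊛-zeroʳ E n) (merge 0 (C 0) (e 0 refl) n) ⟩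
      + 0 ℤ.+ (E ⊛ (mono (k * 0) ⊛ C 0)) n ≡⟨ ℤₚ.+-identityˡ _ ⟩
      (E ⊛ (mono (k * 0) ⊛ C 0)) n      ≡⟨ cong (λ d → (E ⊛ (mono d ⊛ C 0)) n) (ℕₚ.*-zeroʳ k) ⟩
      (E ⊛ (one ⊛ C 0)) n               ≡⟨ ⊛-congˡ E (⊛-identityˡ (C 0)) n ⟩
      (E ⊛ C 0) n                       ∎
    go -[1+ suc M ] _ refl e = begin
      (E ⊛ 𝟘 ⊕ B ⊛ (E′ ⊛ 𝟘)) n          ≡⟨ cong₂ ℤ._+_ (⊛-zeroʳ E n) (⊛-congˡ B (⊛-zeroʳ E′) n) ⟩
      + 0 ℤ.+ (B ⊛ 𝟘) n                 ≡⟨ cong (λ z → + 0 ℤ.+ z) (⊛-zeroʳ B n) ⟩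
      + 0                               ≡⟨ ⊛-zeroʳ E n ⟨
      (E ⊛ 𝟘) n                         ∎

  W-step : ∀ l j → W l j ⊕ (-[1+ 0 ] • (mono (b + k * l) ⊛ W l (ℤ.suc j))) ≗ W (suc l) j
  W-step l j n = begin
    εℤ j ℤ.* X ℤ.+ -[1+ 0 ] ℤ.* (mono (b + k * l) ⊛ W l (ℤ.suc j)) n
      ≡⟨ cong (λ z → εℤ j ℤ.* X ℤ.+ -[1+ 0 ] ℤ.* z)
           (⊛-•ʳ (εℤ (ℤ.suc j)) (mono (b + k * l)) (mono (exponent (ℤ.suc j)) ⊛ Cℤ (+ l ℤ.+ ℤ.suc j)) n) ⟩
    εℤ j ℤ.* X ℤ.+ -[1+ 0 ] ℤ.* (εℤ (ℤ.suc j) ℤ.* Y)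
      ≡⟨ cong (λ z → z ℤ.* X ℤ.+ -[1+ 0 ] ℤ.* (εℤ (ℤ.suc j) ℤ.* Y)) (εℤ-suc j) ⟩
    ℤ.- εℤ (ℤ.suc j) ℤ.* X ℤ.+ -[1+ 0 ] ℤ.* (εℤ (ℤ.suc j) ℤ.* Y)
      ≡⟨ lemma (εℤ (ℤ.suc j)) X Y ⟩
    ℤ.- εℤ (ℤ.suc j) ℤ.* (X ℤ.+ Y)
      ≡⟨ cong₂ ℤ._*_ (sym (εℤ-suc j)) (Cℤ-step l j n) ⟩
    εℤ j ℤ.* (mono (exponent j) ⊛ Cℤ (+ l ℤ.+ ℤ.suc j)) n
      ≡⟨ cong (λ J → εℤ j ℤ.* (mono (exponent j) ⊛ Cℤ J) n) (shift-suc (+ l) j) ⟩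
    W (suc l) j n ∎
    where
    open ≡-Reasoning
    X = (mono (exponent j) ⊛ Cℤ (+ l ℤ.+ j)) n
    Y = (mono (b + k * l) ⊛ (mono (exponent (ℤ.suc j)) ⊛ Cℤ (+ l ℤ.+ ℤ.suc j))) n
    lemma : ∀ s x y → (ℤ.- s) ℤ.* x ℤ.+ -[1+ 0 ] ℤ.* (s ℤ.* y) ≡ (ℤ.- s) ℤ.* (x ℤ.+ y)
    lemma = solve-∀
    shift-suc : ∀ x y → x ℤ.+ (+ 1 ℤ.+ y) ≡ (+ 1 ℤ.+ x) ℤ.+ y
    shift-suc = solve-∀

  partial : ℕ → PS
  partial l = finprod (factor b k) l ⊛ (poch a k ⊛ C 0)

  W-isSum : ∀ l → IsSum (W l) (partial l)
  W-isSum zero    = isSum-cong (λ _ _ → refl) (λ n → sym (⊛-identityˡ (poch a k ⊛ C 0) n)) W₀-isSum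
  W-isSum (suc l) = isSum-cong (W-step l) value
    (isSum-+ ℤₚ._≟_ (W-isSum l) (isSum-• -[1+ 0 ] (isSum-⊛ˡ (mono (b + k * l))
      (isSum-reindex ℤ.suc ℤ.pred ℤₚ.suc-pred ℤₚ.pred-suc (W-isSum l)))))
    where
    open ≡-Reasoning
    P = finprod (factor b k) l
    X = poch a k ⊛ C 0
    value : partial l ⊕ (-[1+ 0 ] • (mono (b + k * l) ⊛ partial l)) ≗ partial (suc l)
    value n = begin
      (partial l ⊕ (-[1+ 0 ] • (mono (b + k * l) ⊛ partial l))) n  ≡⟨ one⊝-⊛ (b + k * l) (partial l) n ⟨
      (factor b k l ⊛ (P ⊛ X)) n        ≡⟨ ⊛-assoc (factor b k l) P X n ⟨
      ((factor b k l ⊛ P) ⊛ X) n        ≡⟨ ⊛-congʳ X (⊛-comm (factor b k l) P) n ⟩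
      partial (suc l) n                 ∎

  ∣j∣≤exponent : ∀ j → ℤ.∣ j ∣ ≤ exponent j
  ∣j∣≤exponent (+ n)    = j≤pos a 1≤a n
  ∣j∣≤exponent -[1+ n ] = j≤pos b 1≤b (suc n)

  Cℤ-low : ∀ N l j i → ℤ.∣ j ∣ ≤ N → N + N ≤ l → i ≤ N → Cℤ (+ l ℤ.+ j) i ≡ one i
  Cℤ-low N l j i ∣j∣≤N 2N≤l i≤N = go j ∣j∣≤N
    where
    C-low : ∀ M → N ≤ M → C M i ≡ one i
    C-low M N≤M = poch-low (k * suc M) k i
      (ℕₚ.<-≤-trans (s≤s (ℕₚ.≤-trans i≤N N≤M)) (m≤r+k*m 0 k (suc M) 1≤k))
    N≤l : N ≤ l
    N≤l = ℕₚ.≤-trans (ℕₚ.m≤m+n N N) 2N≤l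
    go : ∀ j → ℤ.∣ j ∣ ≤ N → Cℤ (+ l ℤ.+ j) i ≡ one i
    go (+ n)    _    = C-low (l + n) (ℕₚ.≤-trans N≤l (ℕₚ.m≤m+n l n))
    go -[1+ n ] 1+n≤N = trans (cong (λ J → Cℤ J i) (ℤₚ.⊖-≥ (ℕₚ.≤-trans 1+n≤N N≤l)))
      (C-low (l ∸ suc n) (ℕₚ.≤-trans (ℕₚ.m+n≤o⇒m≤o∸n N 2N≤l) (ℕₚ.∸-monoʳ-≤ l 1+n≤N)))

  tripleProduct : IsSum (λ j → εℤ j • mono (exponent j)) (poch a k ⊛ poch b k ⊛ poch k k)
  -- Twice N keeps l + j above N for every |j| ≤ N; the `suc` gives the finite product more than N
  -- factors even when N = 0.
  tripleProduct = isSum-limit (λ N → suc (N + N)) terms values W-isSum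
    where
    open ≡-Reasoning
    terms : ∀ N j n → n ≤ N → W (suc (N + N)) j n ≡ εℤ j ℤ.* mono (exponent j) n
    terms N j n n≤N = cong (εℤ j ℤ.*_) (coefficient (exponent j ℕₚ.≤? N))
      where
      coefficient : Dec (exponent j ≤ N) →
        (mono (exponent j) ⊛ Cℤ (+ suc (N + N) ℤ.+ j)) n ≡ mono (exponent j) n
      coefficient (yes e≤N) = trans
        (⊛-cong≤ n {mono (exponent j)} (λ _ _ → refl)
          (λ i i≤n → Cℤ-low N (suc (N + N)) j i (ℕₚ.≤-trans (∣j∣≤exponent j) e≤N) (ℕₚ.n≤1+n (N + N)) (ℕₚ.≤-trans i≤n n≤N)))
        (⊛-identityʳ (mono (exponent j)) n)
      coefficient (no e≰N) = trans (⊛-mono-< (exponent j) (Cℤ (+ suc (N + N) ℤ.+ j)) n n<e) (sym (mono-< (exponent j) n n<e))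
        where
        n<e = ℕₚ.≤-<-trans n≤N (ℕₚ.≰⇒> e≰N)
    values : ∀ N n → n ≤ N → partial (suc (N + N)) n ≡ (poch a k ⊛ poch b k ⊛ poch k k) n
    values N n n≤N = begin
      partial (suc (N + N)) n
        ≡⟨ ⊛-cong≤ n {g = poch a k ⊛ C 0} (λ i i≤n → finprod-stable b k 1≤k i (suc (N + N))
             (s≤s (ℕₚ.≤-trans (ℕₚ.≤-trans i≤n n≤N) (ℕₚ.m≤m+n N N)))) (λ _ _ → refl) ⟩
      (poch b k ⊛ (poch a k ⊛ C 0)) n
        ≡⟨ ⊛-assoc (poch b k) (poch a k) (C 0) n ⟨
      (poch b k ⊛ poch a k ⊛ C 0) n
        ≡⟨ cong (λ r → (poch b k ⊛ poch a k ⊛ poch r k) n) (ℕₚ.*-identityʳ k) ⟩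
      (poch b k ⊛ poch a k ⊛ poch k k) n
        ≡⟨ ⊛-congʳ (poch k k) (⊛-comm (poch b k) (poch a k)) n ⟩
      (poch a k ⊛ poch b k ⊛ poch k k) n ∎

-- Combinations of theta series of one and two variables

isSum-Fin-suc : ∀ {J : Set} {p} → DecidableEquality J → ∀ {F : Fin (suc p) × J → PS} {s} → IsSum F s →
  ∃ λ t → ∃ λ u → IsSum (λ j → F (Fin.zero , j)) t × IsSum (λ (r , j) → F (Fin.suc r , j)) u × (s ≗ t ⊕ u)
isSum-Fin-suc {J} {p} _≟_ sum =
  isSum-⊎ _≟_ (Prod.≡-dec Finₚ._≟_ _≟_) (isSum-reindex φ ψ φψ ψφ sum)
  where
  φ : J ⊎ (Fin p × J) → Fin (suc p) × J
  φ (inj₁ j)       = Fin.zero , j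
  φ (inj₂ (r , j)) = Fin.suc r , j
  ψ : Fin (suc p) × J → J ⊎ (Fin p × J)
  ψ (Fin.zero , j)  = inj₁ j
  ψ (Fin.suc r , j) = inj₂ (r , j)
  φψ : ∀ x → φ (ψ x) ≡ x
  φψ (Fin.zero , j)  = refl
  φψ (Fin.suc r , j) = refl
  ψφ : ∀ x → ψ (φ x) ≡ x
  ψφ (inj₁ j)       = refl
  ψφ (inj₂ (r , j)) = refl

module Combination {X I : Set} (term : X → I → PS) where

  Combo : Set
  Combo = List (ℤ × X)

  -- The values of the single entries stay existential: a piece of a dissected theta series has no
  -- closed form, and only the total is compared.
  Total : Combo → PS → Set
  Total []             s = s ≗ 𝟘
  Total ((w , x) ∷ xs) s = ∃ λ t → ∃ λ u → IsSum (λ i → w • term x i) t × Total xs u × (s ≗ t ⊕ u)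

  Total-cong : ∀ xs {s t} → s ≗ t → Total xs s → Total xs t
  Total-cong []       s≗t s≗0                   n = trans (sym (s≗t n)) (s≗0 n)
  Total-cong (x ∷ xs) s≗t (u , v , p , q , s≗u+v) =
    u , v , p , q , λ n → trans (sym (s≗t n)) (s≗u+v n)

  Total-++ : ∀ xs {ys s t} → Total xs s → Total ys t → Total (xs ++ ys) (s ⊕ t)
  Total-++ [] {ys} s≗0 q =
    Total-cong ys (λ n → sym (trans (cong (ℤ._+ _) (s≗0 n)) (ℤₚ.+-identityˡ _))) q
  Total-++ (x ∷ xs) {t = t} (u , v , p , r , s≗u+v) q =
    u , v ⊕ t , p , Total-++ xs r q ,
    λ n → trans (cong (ℤ._+ t n) (s≗u+v n)) (ℤₚ.+-assoc (u n) (v n) (t n))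

  negate : Combo → Combo
  negate = map (λ (w , x) → ℤ.- w , x)

  Total-negate : ∀ xs {s} → Total xs s → Total (negate xs) (-[1+ 0 ] • s)
  Total-negate []             s≗0 n = cong (-[1+ 0 ] ℤ.*_) (s≗0 n)
  Total-negate ((w , x) ∷ xs) (u , v , p , q , s≗u+v) =
    -[1+ 0 ] • u , -[1+ 0 ] • v ,
    isSum-cong (λ i n → lemma w (term x i n)) (λ _ → refl) (isSum-• -[1+ 0 ] p) ,
    Total-negate xs q ,
    λ n → trans (cong (-[1+ 0 ] ℤ.*_) (s≗u+v n)) (ℤₚ.*-distribˡ-+ -[1+ 0 ] (u n) (v n))
    where
    lemma : ∀ w y → -[1+ 0 ] ℤ.* (w ℤ.* y) ≡ (ℤ.- w) ℤ.* y
    lemma = solve-∀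

  Total-tabulate : ∀ {J : Set} p {s} {F : Fin p × J → PS} (w : Fin p → ℤ) (x : Fin p → X) →
    DecidableEquality J →
    (∀ r {t} → IsSum (λ j → F (r , j)) t → IsSum (λ i → w r • term (x r) i) t) →
    IsSum F s → Total (tabulate (λ r → w r , x r)) s
  Total-tabulate {J} zero w x _≟_ f sum n =
    trans (sym (IsSum.total sum n n ℕₚ.≤-refl)) (empty (IsSum.support sum n))
    where
    empty : ∀ (js : List (Fin 0 × J)) {g} → Σᴸ js g ≡ + 0
    empty []             = refl
    empty ((() , _) ∷ _)
  Total-tabulate {J} (suc p) w x _≟_ f sum
    with t , u , sumₗ , sumᵣ , s≗t+u ← isSum-Fin-suc _≟_ sum
    = t , u , f Fin.zero sumₗ , Total-tabulate p (w ∘ Fin.suc) (x ∘ Fin.suc) _≟_ (f ∘ Fin.suc) sumᵣ , s≗t+u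

  module Cancel (_≟ˣ_ : DecidableEquality X) (_≟ⁱ_ : DecidableEquality I) where

    extract : ℤ × X → Combo → Maybe Combo
    extract y []       = nothing
    extract y (x ∷ xs) with Prod.≡-dec ℤₚ._≟_ _≟ˣ_ y x | extract y xs
    ... | yes _ | _       = just xs
    ... | no  _ | just zs = just (x ∷ zs)
    ... | no  _ | nothing = nothing

    Total-extract : ∀ y xs {zs s} → extract y xs ≡ just zs → Total xs s → Total (y ∷ zs) s
    Total-extract y (x ∷ xs) eq total with Prod.≡-dec ℤₚ._≟_ _≟ˣ_ y x | extract y xs in eq′
    Total-extract y (x ∷ xs) refl total                     | yes refl | _       = total
    Total-extract y (x ∷ xs) refl (t , u , p , q , s≗t+u) | no _     | just zs
      with v , r , p′ , q′ , u≗v+r ← Total-extract y xs eq′ q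
      = v , t ⊕ r , p′ , (t , r , p , q′ , (λ _ → refl)) ,
        λ n → trans (s≗t+u n) (trans (cong (λ z → t n ℤ.+ z) (u≗v+r n)) (lemma (t n) (v n) (r n)))
      where
      lemma : ∀ a b c → a ℤ.+ (b ℤ.+ c) ≡ b ℤ.+ (a ℤ.+ c)
      lemma = solve-∀

    insert : ℤ × X → Combo → Combo
    insert (w , x) xs with extract (ℤ.- w , x) xs
    ... | just zs = zs
    ... | nothing = (w , x) ∷ xs

    cancel : Combo → Combo
    cancel []       = []
    cancel (x ∷ xs) = insert x (cancel xs)

    -- Entries that differ only in the sign of the weight have opposite values by the uniqueness of
    -- locally finite sums; this is the only way in which sums are ever compared.
    Total-insert : ∀ x xs {s} → Total (x ∷ xs) s → Total (insert x xs) s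
    Total-insert (w , x) xs (t , u , p , q , s≗t+u) with extract (ℤ.- w , x) xs in eq
    ... | nothing = t , u , p , q , s≗t+u
    ... | just zs with v , r , p′ , q′ , u≗v+r ← Total-extract (ℤ.- w , x) xs eq q
      = Total-cong zs (λ n → sym (begin
          _                                   ≡⟨ s≗t+u n ⟩
          t n ℤ.+ u n                         ≡⟨ cong₂ ℤ._+_ (t≗-v n) (u≗v+r n) ⟩
          -[1+ 0 ] ℤ.* v n ℤ.+ (v n ℤ.+ r n)  ≡⟨ lemma₂ (v n) (r n) ⟩
          r n                                 ∎)) q′
      where
      open ≡-Reasoning
      lemma₁ : ∀ w y → -[1+ 0 ] ℤ.* ((ℤ.- w) ℤ.* y) ≡ w ℤ.* y
      lemma₁ = solve-∀
      lemma₂ : ∀ v r → -[1+ 0 ] ℤ.* v ℤ.+ (v ℤ.+ r) ≡ r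
      lemma₂ = solve-∀
      t≗-v : t ≗ -[1+ 0 ] • v
      t≗-v = isSum-unique _≟ⁱ_ p
        (isSum-cong (λ i n → lemma₁ w (term x i n)) (λ _ → refl) (isSum-• -[1+ 0 ] p′))

    Total-cancel : ∀ xs {s} → Total xs s → Total (cancel xs) s
    Total-cancel []       s≗0                     = s≗0
    Total-cancel (x ∷ xs) (t , u , p , q , s≗t+u) =
      Total-insert x (cancel xs) (t , u , p , Total-cancel xs q , s≗t+u)

-- Integer exponents let substitutions act through ring identities. The value at negative ones is
-- junk: the exponents that occur are values of a `Theta` or sums of two such values, which are
-- natural numbers by `value-bound`.
q^_ : ℤ → PS
q^ (+ e)    = mono e
q^ -[1+ _ ] = 𝟘

record Theta : Set where
  constructor θ
  field
    lead      : ℕ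
    linear    : ℤ
    const     : ℕ
    {bounded} : T (ℤ.∣ linear ∣ <ᵇ lead)

value : Theta → ℤ → ℤ
value (θ A D F) x = + A ℤ.* (x ℤ.* x) ℤ.+ D ℤ.* x ℤ.+ + F

i*i≡∣i∣*∣i∣ : ∀ i → i ℤ.* i ≡ + (ℤ.∣ i ∣ * ℤ.∣ i ∣)
i*i≡∣i∣*∣i∣ (+ n)    = sym (ℤₚ.pos-* n n)
i*i≡∣i∣*∣i∣ -[1+ n ] = refl

n≤n*n : ∀ n → n ≤ n * n
n≤n*n zero    = z≤n
n≤n*n (suc n) = ℕₚ.m≤m*n (suc n) (suc n)

-- As |D| < A and |x| ≤ x², we have |D x| + |x| ≤ A x². The bound on |x| is what makes theta series
-- locally finite.
value-bound : ∀ u x → ∃ λ e → value u x ≡ + e × ℤ.∣ x ∣ ≤ e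
value-bound (θ A D F {b}) x =
  let e , eq , n≤e = dominate (A * (n * n)) (D ℤ.* x) F bound in
  e , trans (cong (λ z → z ℤ.+ D ℤ.* x ℤ.+ + F) square) eq , n≤e
  where
  n = ℤ.∣ x ∣
  square : + A ℤ.* (x ℤ.* x) ≡ + (A * (n * n))
  square = trans (cong (+ A ℤ.*_) (i*i≡∣i∣*∣i∣ x)) (sym (ℤₚ.pos-* A (n * n)))
  bound : ℤ.∣ D ℤ.* x ∣ + n ≤ A * (n * n)
  bound = begin
    ℤ.∣ D ℤ.* x ∣ + n          ≡⟨ cong (_+ n) (ℤₚ.abs-* D x) ⟩
    ℤ.∣ D ∣ * n + n            ≡⟨ ℕₚ.+-comm (ℤ.∣ D ∣ * n) n ⟩
    suc ℤ.∣ D ∣ * n            ≤⟨ ℕₚ.*-mono-≤ (ℕₚ.<ᵇ⇒< ℤ.∣ D ∣ A b) (n≤n*n n) ⟩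
    A * (n * n)                ∎
    where open ℕₚ.≤-Reasoning
  dominate : ∀ P y F → ℤ.∣ y ∣ + n ≤ P → ∃ λ e → + P ℤ.+ y ℤ.+ + F ≡ + e × n ≤ e
  dominate P (+ m) F le = P + m + F , refl ,
    ℕₚ.≤-trans (ℕₚ.≤-trans (ℕₚ.m≤n+m n m) le) (ℕₚ.≤-trans (ℕₚ.m≤m+n P m) (ℕₚ.m≤m+n (P + m) F))
  dominate P -[1+ m ] F le = P ∸ suc m + F ,
    cong (ℤ._+ + F) (ℤₚ.⊖-≥ (ℕₚ.≤-trans (ℕₚ.m≤m+n (suc m) n) le)) ,
    ℕₚ.≤-trans (ℕₚ.m+n≤o⇒m≤o∸n n (subst (_≤ P) (ℕₚ.+-comm (suc m) n) le)) (ℕₚ.m≤m+n (P ∸ suc m) F)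

interval : ℕ → List ℤ
interval N = map +_ (upTo (suc N)) ++ map -[1+_] (upTo N)

∈-interval : ∀ N x → ℤ.∣ x ∣ ≤ N → x ∈ interval N
∈-interval N (+ n)    n≤N = ∈.∈-++⁺ˡ (∈.∈-map⁺ +_ (∈.∈-upTo⁺ (s≤s n≤N)))
∈-interval N -[1+ n ] n<N = ∈.∈-++⁺ʳ (map +_ (upTo (suc N))) (∈.∈-map⁺ -[1+_] (∈.∈-upTo⁺ n<N))

interval-unique : ∀ N → Unique (interval N)
interval-unique N = Unique.++⁺
  (Unique.map⁺ ℤₚ.+-injective (Unique.upTo⁺ (suc N)))
  (Unique.map⁺ ℤₚ.-[1+-injective (Unique.upTo⁺ N))
  λ (p , q) → disjoint (proj₂ (proj₂ (∈.∈-map⁻ +_ p))) (proj₂ (proj₂ (∈.∈-map⁻ -[1+_] q)))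
  where
  disjoint : ∀ {x m n} → x ≡ + m → x ≢ -[1+ n ]
  disjoint refl ()

theta-isSum : ∀ u → ∃ λ s → IsSum (λ x → q^ value u x) s
theta-isSum u = _ , isSum-exists ℤₚ._≟_ interval interval-unique cover
  where
  cover : ∀ N x n → n ≤ N → x ∈ interval N ⊎ (q^ value u x) n ≡ + 0
  cover N x n n≤N with ℤ.∣ x ∣ ℕₚ.≤? N | value-bound u x
  ... | yes ∣x∣≤N | _ = inj₁ (∈-interval N x ∣x∣≤N)
  ... | no  ∣x∣≰N | e , eq , ∣x∣≤e = inj₂ (trans (cong (λ z → (q^ z) n) eq)
    (mono-< e n (ℕₚ.<-≤-trans (ℕₚ.≤-<-trans n≤N (ℕₚ.≰⇒> ∣x∣≰N)) ∣x∣≤e)))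

-- Quadratic polynomials in two variables under affine substitutions

record Form : Set where
  constructor form
  field
    xx xy yy x¹ y¹ c : ℤ

eval : Form → ℤ × ℤ → ℤ
eval (form A B C D E F) (x , y) =
  A ℤ.* (x ℤ.* x) ℤ.+ B ℤ.* (x ℤ.* y) ℤ.+ C ℤ.* (y ℤ.* y) ℤ.+ D ℤ.* x ℤ.+ E ℤ.* y ℤ.+ F

record Affine : Set where
  constructor affine
  field
    a b c d e f : ℤ

apply : Affine → ℤ × ℤ → ℤ × ℤ
apply (affine a b c d e f) (x , y) = a ℤ.* x ℤ.+ b ℤ.* y ℤ.+ c , d ℤ.* x ℤ.+ e ℤ.* y ℤ.+ f

pullback : Affine → Form → Form
pullback (affine a b c d e f) (form A B C D E F) = form
  (A ℤ.* (a ℤ.* a) ℤ.+ B ℤ.* (a ℤ.* d) ℤ.+ C ℤ.* (d ℤ.* d))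
  (A ℤ.* (a ℤ.* b) ℤ.+ A ℤ.* (a ℤ.* b) ℤ.+ B ℤ.* (a ℤ.* e ℤ.+ b ℤ.* d) ℤ.+ C ℤ.* (d ℤ.* e) ℤ.+ C ℤ.* (d ℤ.* e))
  (A ℤ.* (b ℤ.* b) ℤ.+ B ℤ.* (b ℤ.* e) ℤ.+ C ℤ.* (e ℤ.* e))
  (A ℤ.* (a ℤ.* c) ℤ.+ A ℤ.* (a ℤ.* c) ℤ.+ B ℤ.* (a ℤ.* f ℤ.+ c ℤ.* d) ℤ.+ C ℤ.* (d ℤ.* f) ℤ.+ C ℤ.* (d ℤ.* f) ℤ.+ D ℤ.* a ℤ.+ E ℤ.* d)
  (A ℤ.* (b ℤ.* c) ℤ.+ A ℤ.* (b ℤ.* c) ℤ.+ B ℤ.* (b ℤ.* f ℤ.+ c ℤ.* e) ℤ.+ C ℤ.* (e ℤ.* f) ℤ.+ C ℤ.* (e ℤ.* f) ℤ.+ D ℤ.* b ℤ.+ E ℤ.* e)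
  (A ℤ.* (c ℤ.* c) ℤ.+ B ℤ.* (c ℤ.* f) ℤ.+ C ℤ.* (f ℤ.* f) ℤ.+ D ℤ.* c ℤ.+ E ℤ.* f ℤ.+ F)

eval-pullback : ∀ φ g p → eval (pullback φ g) p ≡ eval g (apply φ p)
eval-pullback (affine a b c d e f) (form A B C D E F) (x , y) = lemma a b c d e f A B C D E F x y
  where
  lemma : ∀ a b c d e f A B C D E F x y →
    (A ℤ.* (a ℤ.* a) ℤ.+ B ℤ.* (a ℤ.* d) ℤ.+ C ℤ.* (d ℤ.* d)) ℤ.* (x ℤ.* x) ℤ.+
    (A ℤ.* (a ℤ.* b) ℤ.+ A ℤ.* (a ℤ.* b) ℤ.+ B ℤ.* (a ℤ.* e ℤ.+ b ℤ.* d) ℤ.+ C ℤ.* (d ℤ.* e) ℤ.+ C ℤ.* (d ℤ.* e)) ℤ.* (x ℤ.* y) ℤ.+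
    (A ℤ.* (b ℤ.* b) ℤ.+ B ℤ.* (b ℤ.* e) ℤ.+ C ℤ.* (e ℤ.* e)) ℤ.* (y ℤ.* y) ℤ.+
    (A ℤ.* (a ℤ.* c) ℤ.+ A ℤ.* (a ℤ.* c) ℤ.+ B ℤ.* (a ℤ.* f ℤ.+ c ℤ.* d) ℤ.+ C ℤ.* (d ℤ.* f) ℤ.+ C ℤ.* (d ℤ.* f) ℤ.+ D ℤ.* a ℤ.+ E ℤ.* d) ℤ.* x ℤ.+
    (A ℤ.* (b ℤ.* c) ℤ.+ A ℤ.* (b ℤ.* c) ℤ.+ B ℤ.* (b ℤ.* f ℤ.+ c ℤ.* e) ℤ.+ C ℤ.* (e ℤ.* f) ℤ.+ C ℤ.* (e ℤ.* f) ℤ.+ D ℤ.* b ℤ.+ E ℤ.* e) ℤ.* y ℤ.+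
    (A ℤ.* (c ℤ.* c) ℤ.+ B ℤ.* (c ℤ.* f) ℤ.+ C ℤ.* (f ℤ.* f) ℤ.+ D ℤ.* c ℤ.+ E ℤ.* f ℤ.+ F)
    ≡ A ℤ.* ((a ℤ.* x ℤ.+ b ℤ.* y ℤ.+ c) ℤ.* (a ℤ.* x ℤ.+ b ℤ.* y ℤ.+ c)) ℤ.+
      B ℤ.* ((a ℤ.* x ℤ.+ b ℤ.* y ℤ.+ c) ℤ.* (d ℤ.* x ℤ.+ e ℤ.* y ℤ.+ f)) ℤ.+
      C ℤ.* ((d ℤ.* x ℤ.+ e ℤ.* y ℤ.+ f) ℤ.* (d ℤ.* x ℤ.+ e ℤ.* y ℤ.+ f)) ℤ.+
      D ℤ.* (a ℤ.* x ℤ.+ b ℤ.* y ℤ.+ c) ℤ.+ E ℤ.* (d ℤ.* x ℤ.+ e ℤ.* y ℤ.+ f) ℤ.+ F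
  lemma = solve-∀

compose : Affine → Affine → Affine
compose (affine a b c d e f) (affine a′ b′ c′ d′ e′ f′) = affine
  (a ℤ.* a′ ℤ.+ b ℤ.* d′) (a ℤ.* b′ ℤ.+ b ℤ.* e′) (a ℤ.* c′ ℤ.+ b ℤ.* f′ ℤ.+ c)
  (d ℤ.* a′ ℤ.+ e ℤ.* d′) (d ℤ.* b′ ℤ.+ e ℤ.* e′) (d ℤ.* c′ ℤ.+ e ℤ.* f′ ℤ.+ f)

apply-compose : ∀ φ ψ p → apply (compose φ ψ) p ≡ apply φ (apply ψ p)
apply-compose (affine a b c d e f) (affine a′ b′ c′ d′ e′ f′) (x , y) =
  cong₂ _,_ (lemma a b c a′ b′ c′ d′ e′ f′ x y) (lemma d e f a′ b′ c′ d′ e′ f′ x y)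
  where
  lemma : ∀ a b c a′ b′ c′ d′ e′ f′ x y →
    (a ℤ.* a′ ℤ.+ b ℤ.* d′) ℤ.* x ℤ.+ (a ℤ.* b′ ℤ.+ b ℤ.* e′) ℤ.* y ℤ.+ (a ℤ.* c′ ℤ.+ b ℤ.* f′ ℤ.+ c)
    ≡ a ℤ.* (a′ ℤ.* x ℤ.+ b′ ℤ.* y ℤ.+ c′) ℤ.+ b ℤ.* (d′ ℤ.* x ℤ.+ e′ ℤ.* y ℤ.+ f′) ℤ.+ c
  lemma = solve-∀

identity : Affine
identity = affine (+ 1) (+ 0) (+ 0) (+ 0) (+ 1) (+ 0)

apply-identity : ∀ p → apply identity p ≡ p
apply-identity (x , y) = cong₂ _,_ (lemma₁ x y) (lemma₂ x y)
  where
  lemma₁ : ∀ x y → + 1 ℤ.* x ℤ.+ + 0 ℤ.* y ℤ.+ + 0 ≡ x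
  lemma₁ = solve-∀
  lemma₂ : ∀ x y → + 0 ℤ.* x ℤ.+ + 1 ℤ.* y ℤ.+ + 0 ≡ y
  lemma₂ = solve-∀

-- The inverse of φ when its determinant is ± 1, and junk otherwise.
inverse : Affine → Affine
inverse (affine a b c d e f) = affine
  (δ ℤ.* e) (ℤ.- (δ ℤ.* b)) (δ ℤ.* (b ℤ.* f ℤ.- e ℤ.* c))
  (ℤ.- (δ ℤ.* d)) (δ ℤ.* a) (δ ℤ.* (d ℤ.* c ℤ.- a ℤ.* f))
  where
  δ = a ℤ.* e ℤ.- b ℤ.* d

_≟ᵛ_ : DecidableEquality (Vec ℤ 6)
_≟ᵛ_ = Vec.≡-dec ℤₚ._≟_

_≟ᵃ_ : DecidableEquality Affine
φ ≟ᵃ ψ = map′ (cong fromVec {toVec φ} {toVec ψ}) (cong toVec) (toVec φ ≟ᵛ toVec ψ)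
  where
  toVec : Affine → Vec ℤ 6
  toVec (affine a b c d e f) = a ∷ b ∷ c ∷ d ∷ e ∷ f ∷ []
  fromVec : Vec ℤ 6 → Affine
  fromVec (a ∷ b ∷ c ∷ d ∷ e ∷ f ∷ []) = affine a b c d e f

_≟ᶠ_ : DecidableEquality Form
g ≟ᶠ h = map′ (cong fromVec {toVec g} {toVec h}) (cong toVec) (toVec g ≟ᵛ toVec h)
  where
  toVec : Form → Vec ℤ 6
  toVec (form a b c d e f) = a ∷ b ∷ c ∷ d ∷ e ∷ f ∷ []
  fromVec : Vec ℤ 6 → Form
  fromVec (a ∷ b ∷ c ∷ d ∷ e ∷ f ∷ []) = form a b c d e f

_≟²_ : DecidableEquality (ℤ × ℤ)
_≟²_ = Prod.≡-dec ℤₚ._≟_ ℤₚ._≟_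

-- A change of variables that is not unimodular is ignored, so that no side condition is needed.
move : Affine → Form → Form
move φ g with compose φ (inverse φ) ≟ᵃ identity | compose (inverse φ) φ ≟ᵃ identity
... | yes _ | yes _ = pullback φ g
... | _     | _     = g

module Unary  = Combination (λ u x → q^ value u x)
module Binary = Combination (λ g p → q^ eval g p)
open Binary.Cancel _≟ᶠ_ _≟²_

isSum-move : ∀ φ w g {s} → IsSum (λ p → w • q^ eval g p) s → IsSum (λ p → w • q^ eval (move φ g) p) s
isSum-move φ w g sum with compose φ (inverse φ) ≟ᵃ identity | compose (inverse φ) φ ≟ᵃ identity
... | no  _  | yes _  = sum
... | no  _  | no  _  = sum
... | yes _  | no  _  = sum
... | yes eq | yes eq′ = isSum-cong (λ p n → cong (λ z → w ℤ.* (q^ z) n) (sym (eval-pullback φ g p))) (λ _ → refl)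
  (isSum-reindex (apply φ) (apply (inverse φ))
    (λ p → trans (sym (apply-compose φ (inverse φ) p)) (trans (cong (λ χ → apply χ p) eq) (apply-identity p)))
    (λ p → trans (sym (apply-compose (inverse φ) φ p)) (trans (cong (λ χ → apply χ p) eq′) (apply-identity p)))
    sum)

-- Dissection of lattice sums by residues

module Residues (p : ℕ) .{{_ : NonZero p}} where

  unsplit : Fin p × ℤ → ℤ
  unsplit (r , z) = + toℕ r ℤ.+ z ℤ.* + p

  split : ℤ → Fin p × ℤ
  split z = fromℕ< (n%ℕd<d z p) , z /ℕ p

  unsplit-split : ∀ z → unsplit (split z) ≡ z
  unsplit-split z = trans
    (cong (λ r → + r ℤ.+ (z /ℕ p) ℤ.* + p) (Finₚ.toℕ-fromℕ< (n%ℕd<d z p)))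
    (sym (a≡a%ℕn+[a/ℕn]*n z p))

  unsplit-injective : ∀ {x y} → unsplit x ≡ unsplit y → x ≡ y
  unsplit-injective {r , z} {r′ , z′} eq = cong₂ _,_ r≡r′ z≡z′
    where
    rearrange : ∀ r z r′ z′ p → r ℤ.+ z ℤ.* p ≡ r′ ℤ.+ z′ ℤ.* p → (z ℤ.- z′) ℤ.* p ≡ r′ ℤ.- r
    rearrange r z r′ z′ p eq = begin
      (z ℤ.- z′) ℤ.* p                        ≡⟨ lemma₁ r z z′ p ⟩
      (r ℤ.+ z ℤ.* p) ℤ.- (r ℤ.+ z′ ℤ.* p)    ≡⟨ cong (ℤ._- (r ℤ.+ z′ ℤ.* p)) eq ⟩
      (r′ ℤ.+ z′ ℤ.* p) ℤ.- (r ℤ.+ z′ ℤ.* p)  ≡⟨ lemma₂ r r′ (z′ ℤ.* p) ⟩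
      r′ ℤ.- r                                ∎
      where
      open ≡-Reasoning
      lemma₁ : ∀ r z z′ p → (z ℤ.- z′) ℤ.* p ≡ (r ℤ.+ z ℤ.* p) ℤ.- (r ℤ.+ z′ ℤ.* p)
      lemma₁ = solve-∀
      lemma₂ : ∀ r r′ y → (r′ ℤ.+ y) ℤ.- (r ℤ.+ y) ≡ r′ ℤ.- r
      lemma₂ = solve-∀
    small : ℤ.∣ z ℤ.- z′ ∣ * p < 1 * p
    small = begin-strict
      ℤ.∣ z ℤ.- z′ ∣ * p             ≡⟨ ℤₚ.abs-* (z ℤ.- z′) (+ p) ⟨
      ℤ.∣ (z ℤ.- z′) ℤ.* + p ∣       ≡⟨ cong ℤ.∣_∣ (rearrange (+ toℕ r) z (+ toℕ r′) z′ (+ p) eq) ⟩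
      ℤ.∣ + toℕ r′ ℤ.- + toℕ r ∣     ≡⟨ cong ℤ.∣_∣ (ℤₚ.m-n≡m⊖n (toℕ r′) (toℕ r)) ⟩
      ℤ.∣ toℕ r′ ℤ.⊖ toℕ r ∣         ≤⟨ ℤₚ.∣m⊝n∣≤m⊔n (toℕ r′) (toℕ r) ⟩
      toℕ r′ ℕ.⊔ toℕ r               <⟨ ℕₚ.⊔-pres-<m (Finₚ.toℕ<n r′) (Finₚ.toℕ<n r) ⟩
      p                              ≡⟨ ℕₚ.*-identityˡ p ⟨
      1 * p                          ∎
      where open ℕₚ.≤-Reasoning
    z≡z′ : z ≡ z′
    z≡z′ = ℤₚ.i-j≡0⇒i≡j z z′ (ℤₚ.∣i∣≡0⇒i≡0 (ℕₚ.n<1⇒n≡0 (ℕₚ.*-cancelʳ-< p _ 1 small)))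
    r≡r′ : r ≡ r′
    r≡r′ = Finₚ.toℕ-injective (ℤₚ.+-injective (∙-cancelʳ (AbelianGroup.group ℤₚ.+-0-abelianGroup)
      (z ℤ.* + p) (+ toℕ r) (+ toℕ r′) (trans eq (cong (λ y → + toℕ r′ ℤ.+ y ℤ.* + p) (sym z≡z′)))))

  split-unsplit : ∀ x → split (unsplit x) ≡ x
  split-unsplit x = unsplit-injective (unsplit-split (unsplit x))

-- Move by `shear`, split the first variable by its residue modulo the number of `leaves`,
-- and move each residue class separately.
record Certificate : Set where
  constructor _▹_
  field
    shear    : Affine
    {pred-p} : ℕ
    leaves   : Vec Affine (suc pred-p)

residue : ∀ p → Fin p → Affine
residue p r = affine (+ p) (+ 0) (+ toℕ r) (+ 0) (+ 1) (+ 0)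

expand : Certificate → ℤ × Form → Binary.Combo
expand (_▹_ φ {p} ψs) (w , g) =
  tabulate (λ r → w , move (lookup ψs r) (pullback (residue (suc p) r) (move φ g)))

Total-expand : ∀ C w g {s} → IsSum (λ p → w • q^ eval g p) s → Binary.Total (expand C (w , g)) s
Total-expand (_▹_ φ {p} ψs) w g sum =
  Binary.Total-tabulate (suc p) (λ _ → w)
    (λ r → move (lookup ψs r) (pullback (residue (suc p) r) (move φ g))) _≟²_
    (λ r → isSum-move (lookup ψs r) w (pullback (residue (suc p) r) (move φ g)) ∘ isSum-cong (λ (x , y) n → cong (λ z → w ℤ.* (q^ z) n)
      (trans (cong (eval (move φ g)) (cong₂ _,_ (lemma₁ (+ toℕ r) (+ suc p) x y) (lemma₂ x y)))
             (sym (eval-pullback (residue (suc p) r) (move φ g) (x , y))))) (λ _ → refl))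
    (isSum-reindex
      (λ (r , x , y) → unsplit (r , x) , y)
      (λ (x , y) → proj₁ (split x) , proj₂ (split x) , y)
      (λ (x , y) → cong (_, y) (unsplit-split x))
      (λ (r , x , y) → cong (λ (r′ , x′) → r′ , x′ , y) (split-unsplit (r , x)))
      (isSum-move φ w g sum))
  where
  open Residues (suc p)
  lemma₁ : ∀ r p x y → r ℤ.+ x ℤ.* p ≡ p ℤ.* x ℤ.+ + 0 ℤ.* y ℤ.+ r
  lemma₁ = solve-∀
  lemma₂ : ∀ x y → y ≡ + 0 ℤ.* x ℤ.+ + 1 ℤ.* y ℤ.+ + 0
  lemma₂ = solve-∀

expandAll : List Certificate → Binary.Combo → Binary.Combo
expandAll (C ∷ Cs) (b ∷ bs) = expand C b ++ expandAll Cs bs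
expandAll _        bs       = bs

Total-expandAll : ∀ Cs bs {s} → Binary.Total bs s → Binary.Total (expandAll Cs bs) s
Total-expandAll []       bs             total = total
Total-expandAll (C ∷ Cs) []             total = total
Total-expandAll (C ∷ Cs) ((w , g) ∷ bs) (t , u , p , q , s≗t+u) =
  Binary.Total-cong (expand C (w , g) ++ expandAll Cs bs) (λ n → sym (s≗t+u n))
    (Binary.Total-++ (expand C (w , g)) (Total-expand C w g p) (Total-expandAll Cs bs q))

-- The certificates are listed in the order of xs ++ ys.
Total-check : ∀ Cs xs ys {s t} → Binary.Total xs s → Binary.Total ys t →
  cancel (expandAll Cs (xs ++ Binary.negate ys)) ≡ [] → s ≗ t
Total-check Cs xs ys {s} {t} p q eq n = ℤₚ.i-j≡0⇒i≡j (s n) (t n)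
  (trans (cong (λ z → s n ℤ.+ z) (sym (ℤₚ.-1*i≡-i (t n)))) (zeros n))
  where
  zeros : s ⊕ (-[1+ 0 ] • t) ≗ 𝟘
  zeros = subst (λ bs → Binary.Total bs (s ⊕ (-[1+ 0 ] • t))) eq
    (Total-cancel _ (Total-expandAll Cs (xs ++ Binary.negate ys)
      (Binary.Total-++ xs p (Binary.Total-negate ys q))))

-- Products of theta series as sums over ℤ²

_⊗ᶿ_ : Theta → Theta → Form
θ A D F ⊗ᶿ θ A′ D′ F′ = form (+ A) (+ 0) (+ A′) D D′ (+ F ℤ.+ + F′)

q^-⊗ : ∀ u v x y → (q^ value u x) ⊛ (q^ value v y) ≗ q^ eval (u ⊗ᶿ v) (x , y)
q^-⊗ u@(θ A D F) v@(θ A′ D′ F′) x y n with value-bound u x | value-bound v y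
... | e , eq , _ | e′ , eq′ , _ = begin
  ((q^ value u x) ⊛ (q^ value v y)) n   ≡⟨ cong₂ (λ z z′ → ((q^ z) ⊛ (q^ z′)) n) eq eq′ ⟩
  (mono e ⊛ mono e′) n                  ≡⟨ ⊛-mono-mono e e′ n ⟩
  (q^ (+ e ℤ.+ + e′)) n                 ≡⟨ cong₂ (λ z z′ → (q^ (z ℤ.+ z′)) n) eq eq′ ⟨
  (q^ (value u x ℤ.+ value v y)) n      ≡⟨ cong (λ z → (q^ z) n) (lemma (+ A) D (+ F) (+ A′) D′ (+ F′) x y) ⟩
  (q^ eval (u ⊗ᶿ v) (x , y)) n          ∎
  where
  open ≡-Reasoning
  lemma : ∀ A D F A′ D′ F′ x y →
    (A ℤ.* (x ℤ.* x) ℤ.+ D ℤ.* x ℤ.+ F) ℤ.+ (A′ ℤ.* (y ℤ.* y) ℤ.+ D′ ℤ.* y ℤ.+ F′)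
    ≡ A ℤ.* (x ℤ.* x) ℤ.+ + 0 ℤ.* (x ℤ.* y) ℤ.+ A′ ℤ.* (y ℤ.* y) ℤ.+ D ℤ.* x ℤ.+ D′ ℤ.* y ℤ.+ (F ℤ.+ F′)
  lemma = solve-∀

_⊗₁_ : ℤ × Theta → Unary.Combo → Binary.Combo
(w , u) ⊗₁ vs = map (λ (w′ , v) → w ℤ.* w′ , u ⊗ᶿ v) vs

_⊗_ : Unary.Combo → Unary.Combo → Binary.Combo
us ⊗ vs = concatMap (_⊗₁ vs) us

Total-⊗₁ : ∀ w u vs {s t} → IsSum (λ x → w • q^ value u x) s → Unary.Total vs t →
           Binary.Total ((w , u) ⊗₁ vs) (s ⊛ t)
Total-⊗₁ w u []              {s} {t} p t≗0 n = trans (⊛-comm s t n) (trans (⊛-congʳ s t≗0 n) (⊛-zeroˡ s n))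
Total-⊗₁ w u ((w′ , v) ∷ vs) {s} p (y , z , q , r , t≗y+z) =
  s ⊛ y , s ⊛ z , isSum-cong product (λ _ → refl) (isSum-⊛ p q) , Total-⊗₁ w u vs p r ,
  λ n → trans (⊛-congˡ s t≗y+z n) (⊛-distribˡ s y z n)
  where
  open ≡-Reasoning
  product : ∀ ij → (w • q^ value u (proj₁ ij)) ⊛ (w′ • q^ value v (proj₂ ij)) ≗ (w ℤ.* w′) • q^ eval (u ⊗ᶿ v) ij
  product (i , j) n = begin
    ((w • U) ⊛ (w′ • V)) n                       ≡⟨ ⊛-•ˡ w U (w′ • V) n ⟩
    w ℤ.* (U ⊛ (w′ • V)) n                       ≡⟨ cong (w ℤ.*_) (⊛-•ʳ w′ U V n) ⟩
    w ℤ.* (w′ ℤ.* (U ⊛ V) n)                     ≡⟨ ℤₚ.*-assoc w w′ _ ⟨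
    w ℤ.* w′ ℤ.* (U ⊛ V) n                       ≡⟨ cong (w ℤ.* w′ ℤ.*_) (q^-⊗ u v i j n) ⟩
    w ℤ.* w′ ℤ.* (q^ eval (u ⊗ᶿ v) (i , j)) n    ∎
    where
    U = q^ value u i
    V = q^ value v j

Total-⊗ : ∀ us vs {s t} → Unary.Total us s → Unary.Total vs t → Binary.Total (us ⊗ vs) (s ⊛ t)
Total-⊗ []             vs {s} {t} s≗0 q n = trans (⊛-congʳ t s≗0 n) (⊛-zeroˡ t n)
Total-⊗ ((w , u) ∷ us) vs {s} {t} (x , y , p , r , s≗x+y) q =
  Binary.Total-cong (((w , u) ∷ us) ⊗ vs)
    (λ n → sym (trans (⊛-congʳ t s≗x+y n) (⊛-distribʳ x y t n)))
    (Binary.Total-++ ((w , u) ⊗₁ vs) (Total-⊗₁ w u vs p q) (Total-⊗ us vs r q))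

Total-thetas : ∀ us → ∃ (Unary.Total us)
Total-thetas []             = 𝟘 , λ _ → refl
Total-thetas ((w , u) ∷ us) with t , p ← theta-isSum u | s , q ← Total-thetas us =
  _ , w • t , s , isSum-• w p , q , λ _ → refl

-- The triple product as a combination of theta series

module JacobiTheta (a d : ℕ) (1≤a : 1 ≤ a) where

  b : ℕ
  b = a + (d + d)

  1≤b : 1 ≤ b
  1≤b = ℕₚ.≤-trans 1≤a (ℕₚ.m≤m+n a (d + d))

  open Jacobi a b 1≤a 1≤b
  open Euler k 1≤k using (pos)

  pos-a : ∀ n → + pos a n ≡ (+ a ℤ.+ + d) ℤ.* (+ n ℤ.* + n) ℤ.- + d ℤ.* + n
  pos-a zero    = sym (lemma (+ a) (+ d))
    where
    lemma : ∀ a d → (a ℤ.+ d) ℤ.* (+ 0 ℤ.* + 0) ℤ.- d ℤ.* + 0 ≡ + 0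
    lemma = solve-∀
  pos-a (suc n) = trans (cong₂ (λ x y → x ℤ.+ (+ a ℤ.+ y)) (pos-a n) (ℤₚ.pos-* k n)) (lemma (+ a) (+ d) (+ n))
    where
    lemma : ∀ a d n → ((a ℤ.+ d) ℤ.* (n ℤ.* n) ℤ.- d ℤ.* n) ℤ.+ (a ℤ.+ (a ℤ.+ (a ℤ.+ (d ℤ.+ d))) ℤ.* n)
      ≡ (a ℤ.+ d) ℤ.* ((+ 1 ℤ.+ n) ℤ.* (+ 1 ℤ.+ n)) ℤ.- d ℤ.* (+ 1 ℤ.+ n)
    lemma = solve-∀

  pos-b : ∀ n → + pos b n ≡ (+ a ℤ.+ + d) ℤ.* (+ n ℤ.* + n) ℤ.+ + d ℤ.* + n
  pos-b zero    = sym (lemma (+ a) (+ d))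
    where
    lemma : ∀ a d → (a ℤ.+ d) ℤ.* (+ 0 ℤ.* + 0) ℤ.+ d ℤ.* + 0 ≡ + 0
    lemma = solve-∀
  pos-b (suc n) = trans (cong₂ (λ x y → x ℤ.+ (+ b ℤ.+ y)) (pos-b n) (ℤₚ.pos-* k n)) (lemma (+ a) (+ d) (+ n))
    where
    lemma : ∀ a d n → ((a ℤ.+ d) ℤ.* (n ℤ.* n) ℤ.+ d ℤ.* n) ℤ.+ ((a ℤ.+ (d ℤ.+ d)) ℤ.+ (a ℤ.+ (a ℤ.+ (d ℤ.+ d))) ℤ.* n)
      ≡ (a ℤ.+ d) ℤ.* ((+ 1 ℤ.+ n) ℤ.* (+ 1 ℤ.+ n)) ℤ.+ d ℤ.* (+ 1 ℤ.+ n)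
    lemma = solve-∀

  -- For b = a + 2d the modulus k = 2 (a + d) is even, so k j (j - 1) / 2 + a j has integral
  -- coefficients.
  exponent-formula : ∀ j → + exponent j ≡ (+ a ℤ.+ + d) ℤ.* (j ℤ.* j) ℤ.- + d ℤ.* j
  exponent-formula (+ n)    = pos-a n
  exponent-formula -[1+ n ] = trans (pos-b (suc n)) (lemma (+ a) (+ d) (+ suc n))
    where
    lemma : ∀ a d n → (a ℤ.+ d) ℤ.* (n ℤ.* n) ℤ.+ d ℤ.* n ≡ (a ℤ.+ d) ℤ.* ((ℤ.- n) ℤ.* (ℤ.- n)) ℤ.- d ℤ.* (ℤ.- n)
    lemma = solve-∀

  εℤ-suc-suc : ∀ j → εℤ j ≡ εℤ (ℤ.suc (ℤ.suc j))
  εℤ-suc-suc j = trans (εℤ-suc j) (trans (cong ℤ.-_ (εℤ-suc (ℤ.suc j))) (ℤₚ.neg-involutive _))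

  εℤ-even : ∀ x → εℤ (x ℤ.* + 2) ≡ + 1
  εℤ-even (+ zero)       = refl
  εℤ-even (+ suc n)      = trans (cong εℤ (lemma (+ n))) (trans (sym (εℤ-suc-suc (+ n ℤ.* + 2))) (εℤ-even (+ n)))
    where
    lemma : ∀ x → (+ 1 ℤ.+ x) ℤ.* + 2 ≡ + 1 ℤ.+ (+ 1 ℤ.+ x ℤ.* + 2)
    lemma = solve-∀
  εℤ-even -[1+ zero ]    = refl
  εℤ-even -[1+ suc n ]   = trans (εℤ-suc-suc (-[1+ suc n ] ℤ.* + 2)) (trans (cong εℤ (lemma (+ suc n))) (εℤ-even -[1+ n ]))
    where
    lemma : ∀ x → + 1 ℤ.+ (+ 1 ℤ.+ (ℤ.- (+ 1 ℤ.+ x)) ℤ.* + 2) ≡ (ℤ.- x) ℤ.* + 2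
    lemma = solve-∀

  εℤ-odd : ∀ x → εℤ (+ 1 ℤ.+ x ℤ.* + 2) ≡ -[1+ 0 ]
  εℤ-odd x = trans (sym (ℤₚ.neg-involutive _)) (cong ℤ.-_ (trans (sym (εℤ-suc (x ℤ.* + 2))) (εℤ-even x)))

-- (q^a, q^b, q^{a+b}; q^{a+b})_∞ with b = a + 2d, its signed sum split by the parity of the index.
jacobi : ∀ a d {p : T (ℤ.∣ ℤ.- + (2 * d) ∣ <ᵇ 4 * (a + d))} {q : T (ℤ.∣ + (4 * a + 2 * d) ∣ <ᵇ 4 * (a + d))} → Unary.Combo
jacobi a d {p} {q} =
  (+ 1 , θ (4 * (a + d)) (ℤ.- + (2 * d)) 0 {p}) ∷
  (-[1+ 0 ] , θ (4 * (a + d)) (+ (4 * a + 2 * d)) a {q}) ∷ []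

Total-jacobi : ∀ a d {p q} → 1 ≤ a → let b = a + (d + d) ; k = a + b in
  Unary.Total (jacobi a d {p} {q}) (poch a k ⊛ poch b k ⊛ poch k k)
Total-jacobi a d {p} {q} 1≤a = Unary.Total-tabulate 2
    (λ { Fin.zero → + 1 ; (Fin.suc Fin.zero) → -[1+ 0 ] })
    (λ { Fin.zero → θ (4 * (a + d)) (ℤ.- + (2 * d)) 0 {p} ; (Fin.suc Fin.zero) → θ (4 * (a + d)) (+ (4 * a + 2 * d)) a {q} })
    ℤₚ._≟_
    (λ { Fin.zero → isSum-cong even (λ _ → refl) ; (Fin.suc Fin.zero) → isSum-cong odd (λ _ → refl) })
    (isSum-reindex unsplit split unsplit-split split-unsplit tripleProduct)
  where
  open JacobiTheta a d 1≤a
  open Jacobi a b 1≤a 1≤b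
  open Residues 2
  lead : + (4 * (a + d)) ≡ + 4 ℤ.* (+ a ℤ.+ + d)
  lead = ℤₚ.pos-* 4 (a + d)
  even : ∀ x → εℤ (+ 0 ℤ.+ x ℤ.* + 2) • mono (exponent (+ 0 ℤ.+ x ℤ.* + 2)) ≗ (+ 1) • q^ value (θ (4 * (a + d)) (ℤ.- + (2 * d)) 0 {p}) x
  even x n = cong₂ (λ s z → s ℤ.* (q^ z) n)
    (trans (cong εℤ (ℤₚ.+-identityˡ (x ℤ.* + 2))) (εℤ-even x))
    (trans (exponent-formula (+ 0 ℤ.+ x ℤ.* + 2)) (trans (lemma (+ a) (+ d) x)
      (cong₂ (λ A D → A ℤ.* (x ℤ.* x) ℤ.+ (ℤ.- D) ℤ.* x ℤ.+ + 0) (sym lead) (sym (ℤₚ.pos-* 2 d)))))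
    where
    lemma : ∀ a d x → (a ℤ.+ d) ℤ.* ((+ 0 ℤ.+ x ℤ.* + 2) ℤ.* (+ 0 ℤ.+ x ℤ.* + 2)) ℤ.- d ℤ.* (+ 0 ℤ.+ x ℤ.* + 2)
      ≡ + 4 ℤ.* (a ℤ.+ d) ℤ.* (x ℤ.* x) ℤ.+ (ℤ.- (+ 2 ℤ.* d)) ℤ.* x ℤ.+ + 0
    lemma = solve-∀
  odd : ∀ x → εℤ (+ 1 ℤ.+ x ℤ.* + 2) • mono (exponent (+ 1 ℤ.+ x ℤ.* + 2)) ≗ -[1+ 0 ] • q^ value (θ (4 * (a + d)) (+ (4 * a + 2 * d)) a {q}) x
  odd x n = cong₂ (λ s z → s ℤ.* (q^ z) n) (εℤ-odd x)
    (trans (exponent-formula (+ 1 ℤ.+ x ℤ.* + 2)) (trans (lemma (+ a) (+ d) x)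
      (cong₂ (λ A D → A ℤ.* (x ℤ.* x) ℤ.+ D ℤ.* x ℤ.+ + a) (sym lead)
        (sym (cong₂ ℤ._+_ (ℤₚ.pos-* 4 a) (ℤₚ.pos-* 2 d))))))
    where
    lemma : ∀ a d x → (a ℤ.+ d) ℤ.* ((+ 1 ℤ.+ x ℤ.* + 2) ℤ.* (+ 1 ℤ.+ x ℤ.* + 2)) ℤ.- d ℤ.* (+ 1 ℤ.+ x ℤ.* + 2)
      ≡ + 4 ℤ.* (a ℤ.+ d) ℤ.* (x ℤ.* x) ℤ.+ (+ 4 ℤ.* a ℤ.+ + 2 ℤ.* d) ℤ.* x ℤ.+ a
    lemma = solve-∀

-- Dissection of infinite products

poch-split : ∀ m r k → 1 ≤ r → 1 ≤ k → poch r k ≗ finprod (λ s → poch (r + k * s) (k * suc m)) (suc m)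
poch-split m r k 1≤r 1≤k n = sym (trans
  (poch-family k 1≤k A one step low r 1≤r n) (⊛-identityʳ (poch r k) n))
  where
  open ≡-Reasoning
  K = k * suc m
  1≤K : 1 ≤ K
  1≤K = ℕₚ.≤-trans 1≤k (ℕₚ.m≤m*n k (suc m))
  A : ℕ → PS
  A r = finprod (λ s → poch (r + k * s) K) (suc m)
  -- Raising r by k moves every factor of the product to the preceding place; the first one,
  -- stripped of 1 - q^r, reappears as the last.
  step : ∀ r → 1 ≤ r → A r ≗ (one ⊝ mono r) ⊛ A (r + k)
  step r _ n = begin
    A r n
      ≡⟨ finprod-head (λ s → poch (r + k * s) K) m n ⟩
    (poch (r + k * 0) K ⊛ finprod (λ s → poch (r + k * suc s) K) m) n
      ≡⟨ ⊛-cong {poch (r + k * 0) K} {F ⊛ last} first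
           (finprod-cong (λ s i → cong (λ x → poch x K i) (trans (cong (_+_ r) (ℕₚ.*-suc k s)) (sym (ℕₚ.+-assoc r k (k * s))))) m) n ⟩
    ((F ⊛ last) ⊛ rest) n
      ≡⟨ ⊛-assoc F last rest n ⟩
    (F ⊛ (last ⊛ rest)) n
      ≡⟨ ⊛-congˡ F (⊛-comm last rest) n ⟩
    (F ⊛ A (r + k)) n ∎
    where
    F = one ⊝ mono r
    rest = finprod (λ s → poch (r + k + k * s) K) m
    last = poch (r + k + k * m) K
    first : poch (r + k * 0) K ≗ F ⊛ last
    first i = begin
      poch (r + k * 0) K i   ≡⟨ cong (λ x → poch x K i) (trans (cong (_+_ r) (ℕₚ.*-zeroʳ k)) (ℕₚ.+-identityʳ r)) ⟩
      poch r K i             ≡⟨ poch-step r K 1≤K i ⟩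
      (F ⊛ poch (r + K) K) i ≡⟨ cong (λ x → (F ⊛ poch x K) i) (trans (cong (_+_ r) (ℕₚ.*-suc k m)) (sym (ℕₚ.+-assoc r k (k * m)))) ⟩
      (F ⊛ last) i           ∎
  low : ∀ r n → 1 ≤ r → n < r → A r n ≡ one n
  low r n _ n<r = go (suc m) n ℕₚ.≤-refl
    where
    go : ∀ l i → i ≤ n → finprod (λ s → poch (r + k * s) K) l i ≡ one i
    go zero    i _   = refl
    go (suc l) i i≤n = trans
      (⊛-cong≤ i (λ j j≤i → go l j (ℕₚ.≤-trans j≤i i≤n))
        (λ j j≤i → poch-low (r + k * l) K j
          (ℕₚ.<-≤-trans (ℕₚ.≤-<-trans (ℕₚ.≤-trans j≤i i≤n) n<r) (ℕₚ.m≤m+n r (k * l)))))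
      (⊛-identityˡ one i)

-- Multiplicative inverses

inv-coefficients : PS → ℕ → List ℤ
inv-coefficients f zero    = inv f 0 ∷ []
inv-coefficients f (suc n) = inv f (suc n) ∷ inv-coefficients f n

invCoeffs≡ : ∀ f n → invCoeffs f n ≡ inv-coefficients f n
invCoeffs≡ f zero    = refl
invCoeffs≡ f (suc n) = cong (inv f (suc n) ∷_) (invCoeffs≡ f n)

-- The inverse's coefficients are listed from degree n down to 0, so zipping them with ascending
-- indices is a convolution. The index map `h` is arbitrary because the recursion turns it into
-- `h ∘ suc`.
inv-convolution : ∀ f (g : PS) (h : ℕ → ℕ) n →
  foldr ℤ._+_ (+ 0) (zipWith (λ j b → g j ℤ.* b) (applyUpTo h (suc n)) (inv-coefficients f n))
  ≡ ((g ∘ h) ⊛ inv f) n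
inv-convolution f g h zero    = ℤₚ.+-comm (g (h 0) ℤ.* inv f 0) (+ 0)
inv-convolution f g h (suc n) = trans
  (cong (λ z → g (h 0) ℤ.* inv f (suc n) ℤ.+ z) (inv-convolution f g (h ∘ suc) n))
  (sym (⊛-head (g ∘ h) (inv f) n))

⊛-inverseʳ : ∀ f → f 0 ≡ + 1 → f ⊛ inv f ≗ one
⊛-inverseʳ f f₀ zero    = cong (λ z → + 0 ℤ.+ z ℤ.* + 1) f₀
⊛-inverseʳ f f₀ (suc n) = begin
  (f ⊛ inv f) (suc n)                           ≡⟨ ⊛-head f (inv f) n ⟩
  f 0 ℤ.* inv f (suc n) ℤ.+ X                   ≡⟨ cong (λ z → z ℤ.* inv f (suc n) ℤ.+ X) f₀ ⟩
  + 1 ℤ.* inv f (suc n) ℤ.+ X                   ≡⟨ cong (λ z → + 1 ℤ.* (ℤ.- z) ℤ.+ X) (trans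
       (cong (λ bs → foldr ℤ._+_ (+ 0) (zipWith (λ j b → f (suc j) ℤ.* b) (upTo (suc n)) bs)) (invCoeffs≡ f n))
       (inv-convolution f (tail f) id n)) ⟩
  + 1 ℤ.* (ℤ.- X) ℤ.+ X                         ≡⟨ lemma X ⟩
  + 0                                           ∎
  where
  open ≡-Reasoning
  X = (tail f ⊛ inv f) n
  lemma : ∀ x → + 1 ℤ.* (ℤ.- x) ℤ.+ x ≡ + 0
  lemma = solve-∀

-- The squares congruent to 49 modulo 240

StrictlyIncreasing : (ℕ → ℕ) → Set
StrictlyIncreasing f = ∀ i j → i < j → f i < f j

n≤increasing : ∀ f → StrictlyIncreasing f → ∀ n → n ≤ f n
n≤increasing f f↑ zero    = z≤n
n≤increasing f f↑ (suc n) = ℕₚ.≤-trans (s≤s (n≤increasing f f↑ n)) (f↑ n (suc n) ℕₚ.≤-refl)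

-- The places at which `f` takes the values of `g` increase strictly, so the n-th place is at least
-- n. Used in both directions, this shows that a set has only one increasing enumeration.
increasing-≤ : ∀ f g → StrictlyIncreasing f → StrictlyIncreasing g →
  (∀ n → ∃ λ m → f m ≡ g n) → ∀ n → f n ≤ g n
increasing-≤ f g f↑ g↑ image n = subst (f n ≤_) (proj₂ (image n)) (f-mono (n≤increasing index index↑ n))
  where
  index : ℕ → ℕ
  index = proj₁ ∘ image
  f-mono : ∀ {i j} → i ≤ j → f i ≤ f j
  f-mono {i} {j} i≤j with ℕₚ.m≤n⇒m<n∨m≡n i≤j
  ... | inj₁ i<j  = ℕₚ.<⇒≤ (f↑ i j i<j)
  ... | inj₂ refl = ℕₚ.≤-refl
  index↑ : StrictlyIncreasing index
  index↑ i j i<j = ℕₚ.≰⇒> λ le → ℕₚ.<⇒≱ (g↑ i j i<j)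
    (subst (_≤ g i) (proj₂ (image j)) (subst (f (index j) ≤_) (proj₂ (image i)) (f-mono le)))

-- The solutions k ≥ 0 of k² ≡ 49 (mod 240), in increasing order.
root : ℕ → ℕ
root 0 = 7
root 1 = 17
root 2 = 23
root 3 = 47
root 4 = 73
root 5 = 97
root 6 = 103
root 7 = 113
root (suc (suc (suc (suc (suc (suc (suc (suc n)))))))) = 120 + root n

root-suc : ∀ n → root n < root (suc n)
root-suc 0 = ℕₚ.<ᵇ⇒< 7 17 _
root-suc 1 = ℕₚ.<ᵇ⇒< 17 23 _
root-suc 2 = ℕₚ.<ᵇ⇒< 23 47 _
root-suc 3 = ℕₚ.<ᵇ⇒< 47 73 _
root-suc 4 = ℕₚ.<ᵇ⇒< 73 97 _
root-suc 5 = ℕₚ.<ᵇ⇒< 97 103 _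
root-suc 6 = ℕₚ.<ᵇ⇒< 103 113 _
root-suc 7 = ℕₚ.<ᵇ⇒< 113 127 _
root-suc (suc (suc (suc (suc (suc (suc (suc (suc n)))))))) = ℕₚ.+-monoʳ-< 120 (root-suc n)

root-increasing : StrictlyIncreasing root
root-increasing i (suc j) i<1+j with ℕₚ.m≤n⇒m<n∨m≡n (ℕₚ.≤-pred i<1+j)
... | inj₁ i<j  = ℕₚ.<-trans (root-increasing i j i<j) (root-suc j)
... | inj₂ refl = root-suc i

square : ∀ n → ∃ λ m → root n * root n ≡ 240 * m + 49
square 0 = 0 , refl
square 1 = 1 , refl
square 2 = 2 , refl
square 3 = 9 , refl
square 4 = 22 , refl
square 5 = 39 , refl
square 6 = 44 , refl
square 7 = 53 , refl
square (suc (suc (suc (suc (suc (suc (suc (suc n)))))))) =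
  let m , eq = square n in
  m + (root n + 60) , trans (lemma₁ (root n)) (trans (cong (λ z → z + 240 * (root n + 60)) eq) (lemma₂ m (root n)))
  where
  lemma₁ : ∀ x → (120 + x) * (120 + x) ≡ x * x + 240 * (x + 60)
  lemma₁ = ℕ-solve-∀
  lemma₂ : ∀ m x → 240 * m + 49 + 240 * (x + 60) ≡ 240 * (m + (x + 60)) + 49
  lemma₂ = ℕ-solve-∀

root-periodic : ∀ t i → root (t * 8 + i) ≡ t * 120 + root i
root-periodic zero    i = refl
root-periodic (suc t) i = trans (cong (_+_ 120) (root-periodic t i)) (sym (ℕₚ.+-assoc 120 (t * 120) (root i)))

root-table : ∀ {r} → r < 120 → r * r % 240 ≡ 49 → ∃ λ i → i < 8 × root i ≡ r
root-table = from-yes (ℕₚ.allUpTo? (λ r → (r * r % 240 ℕₚ.≟ 49) →-dec ℕₚ.anyUpTo? (λ i → root i ℕₚ.≟ r) 8) 120)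

-- (r + 120t)² ≡ r² modulo 240, so only k modulo 120 matters, and `root-table` tests all 120
-- residues.
root-complete : ∀ k m → k * k ≡ 240 * m + 49 → ∃ λ n → root n ≡ k
root-complete k m eq =
  let i , _ , root-i = root-table (m%n<n k 120) square-r in
  t * 8 + i , trans (root-periodic t i) (trans (cong (_+_ (t * 120)) root-i)
    (trans (ℕₚ.+-comm (t * 120) r) (sym (m≡m%n+[m/n]*n k 120))))
  where
  open ≡-Reasoning
  r = k % 120
  t = k / 120
  lemma : ∀ r t → (r + t * 120) * (r + t * 120) ≡ r * r + (r * t + 60 * t * t) * 240
  lemma = ℕ-solve-∀
  square-r : r * r % 240 ≡ 49
  square-r = begin
    r * r % 240                                  ≡⟨ [m+kn]%n≡m%n (r * r) (r * t + 60 * t * t) 240 ⟨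
    (r * r + (r * t + 60 * t * t) * 240) % 240   ≡⟨ cong (_% 240) (lemma r t) ⟨
    (r + t * 120) * (r + t * 120) % 240          ≡⟨ cong (λ x → x * x % 240) (m≡m%n+[m/n]*n k 120) ⟨
    k * k % 240                                  ≡⟨ cong (_% 240) (trans eq (trans (ℕₚ.+-comm (240 * m) 49) (cong (_+_ 49) (ℕₚ.*-comm 240 m)))) ⟩
    (49 + m * 240) % 240                         ≡⟨ [m+kn]%n≡m%n 49 m 240 ⟩
    49                                           ∎

-- The solutions ± (120 j + c), j ∈ ℤ, for the four values c = 7, 17, 23, 47, and their positions in `root`.
offset : Fin 4 → ℕ
offset r = root (toℕ r)

-- The eight roots below 120 are symmetric under c ↦ 120 - c. Hence j = -1 - t leads to block t of
-- `root`, at the mirrored place 7 - r.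
position : Fin 4 × ℤ → ℕ
position (r , + zero)         = toℕ r
position (r , + suc t)        = 8 + position (r , + t)
position (r , -[1+ zero ])    = 7 ∸ toℕ r
position (r , -[1+ suc t ])   = 8 + position (r , -[1+ t ])

next : Fin 4 × ℤ → Fin 4 × ℤ
next (r , + t)      = r , + suc t
next (r , -[1+ t ]) = r , -[1+ suc t ]

locate : ℕ → Fin 4 × ℤ
locate 0 = # 0 , + 0
locate 1 = # 1 , + 0
locate 2 = # 2 , + 0
locate 3 = # 3 , + 0
locate 4 = # 3 , -[1+ 0 ]
locate 5 = # 2 , -[1+ 0 ]
locate 6 = # 1 , -[1+ 0 ]
locate 7 = # 0 , -[1+ 0 ]
locate (suc (suc (suc (suc (suc (suc (suc (suc n)))))))) = next (locate n)

position-next : ∀ x → position (next x) ≡ 8 + position x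
position-next (r , + t)      = refl
position-next (r , -[1+ t ]) = refl

position-locate : ∀ n → position (locate n) ≡ n
position-locate 0 = refl
position-locate 1 = refl
position-locate 2 = refl
position-locate 3 = refl
position-locate 4 = refl
position-locate 5 = refl
position-locate 6 = refl
position-locate 7 = refl
position-locate (suc (suc (suc (suc (suc (suc (suc (suc n)))))))) =
  trans (position-next (locate n)) (cong (_+_ 8) (position-locate n))

Fin4-elim : (P : Fin 4 → Set) → P (# 0) → P (# 1) → P (# 2) → P (# 3) → ∀ r → P r
Fin4-elim P p₀ p₁ p₂ p₃ Fin.zero                               = p₀
Fin4-elim P p₀ p₁ p₂ p₃ (Fin.suc Fin.zero)                     = p₁
Fin4-elim P p₀ p₁ p₂ p₃ (Fin.suc (Fin.suc Fin.zero))           = p₂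
Fin4-elim P p₀ p₁ p₂ p₃ (Fin.suc (Fin.suc (Fin.suc Fin.zero))) = p₃

locate-position : ∀ x → locate (position x) ≡ x
locate-position (r , + zero)       = Fin4-elim (λ r → locate (toℕ r) ≡ (r , + 0)) refl refl refl refl r
locate-position (r , + suc t)      = cong next (locate-position (r , + t))
locate-position (r , -[1+ zero ])  = Fin4-elim (λ r → locate (7 ∸ toℕ r) ≡ (r , -[1+ 0 ])) refl refl refl refl r
locate-position (r , -[1+ suc t ]) = cong next (locate-position (r , -[1+ t ]))

root-position⁺ : ∀ r t → + root (position (r , + t)) ≡ + 120 ℤ.* + t ℤ.+ + offset r
root-position⁺ r zero    = refl
root-position⁺ r (suc t) = trans (cong (λ z → + 120 ℤ.+ z) (root-position⁺ r t)) (lemma (+ t) (+ offset r))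
  where
  lemma : ∀ t c → + 120 ℤ.+ (+ 120 ℤ.* t ℤ.+ c) ≡ + 120 ℤ.* (+ 1 ℤ.+ t) ℤ.+ c
  lemma = solve-∀

root-position⁻ : ∀ r t → + root (position (r , -[1+ t ])) ≡ ℤ.- (+ 120 ℤ.* -[1+ t ] ℤ.+ + offset r)
root-position⁻ r zero    = Fin4-elim (λ r → + root (7 ∸ toℕ r) ≡ ℤ.- (+ 120 ℤ.* -[1+ 0 ] ℤ.+ + offset r)) refl refl refl refl r
root-position⁻ r (suc t) = trans (cong (λ z → + 120 ℤ.+ z) (root-position⁻ r t)) (lemma (+ suc t) (+ offset r))
  where
  lemma : ∀ t c → + 120 ℤ.+ (ℤ.- (+ 120 ℤ.* (ℤ.- t) ℤ.+ c)) ≡ ℤ.- (+ 120 ℤ.* (ℤ.- (+ 1 ℤ.+ t)) ℤ.+ c)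
  lemma = solve-∀

root-position² : ∀ r j → let k = + root (position (r , j)) ; l = + 120 ℤ.* j ℤ.+ + offset r in k ℤ.* k ≡ l ℤ.* l
root-position² r (+ t)      = cong₂ ℤ._*_ (root-position⁺ r t) (root-position⁺ r t)
root-position² r -[1+ t ]   = trans (cong₂ ℤ._*_ (root-position⁻ r t) (root-position⁻ r t)) (lemma (+ 120 ℤ.* -[1+ t ] ℤ.+ + offset r))
  where
  lemma : ∀ x → (ℤ.- x) ℤ.* (ℤ.- x) ≡ x ℤ.* x
  lemma = solve-∀

signOf : Fin 4 → ℤ
signOf r = sgn (toℕ r)

sgn-cong : ∀ m n → (5 * m / 4) % 2 ≡ (5 * n / 4) % 2 → sgn m ≡ sgn n
sgn-cong m n eq with (5 * m / 4) % 2 | (5 * n / 4) % 2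
sgn-cong m n refl | zero  | _ = refl
sgn-cong m n refl | suc _ | _ = refl

sgn-periodic : ∀ n → sgn (8 + n) ≡ sgn n
sgn-periodic n = sgn-cong (8 + n) n (begin
  (5 * (8 + n) / 4) % 2     ≡⟨ cong (λ x → (x / 4) % 2) (ℕₚ.*-distribˡ-+ 5 8 n) ⟩
  ((40 + 5 * n) / 4) % 2    ≡⟨ cong (_% 2) (+-distrib-/-∣ˡ {40} (5 * n) {4} (divides 10 refl)) ⟩
  (10 + 5 * n / 4) % 2      ≡⟨ cong (_% 2) (ℕₚ.+-comm 10 (5 * n / 4)) ⟩
  (5 * n / 4 + 5 * 2) % 2   ≡⟨ [m+kn]%n≡m%n (5 * n / 4) 5 2 ⟩
  (5 * n / 4) % 2           ∎)
  where open ≡-Reasoning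

-- The parity of ⌊5n/4⌋ has period 8 and is symmetric under n ↦ 7 - n, so the sign is constant on
-- each of the four bilateral progressions.
sgn-position : ∀ r j → sgn (position (r , j)) ≡ signOf r
sgn-position r (+ zero)       = refl
sgn-position r (+ suc t)      = trans (sgn-periodic (position (r , + t))) (sgn-position r (+ t))
sgn-position r -[1+ zero ]    = Fin4-elim (λ r → sgn (7 ∸ toℕ r) ≡ signOf r) refl refl refl refl r
sgn-position r -[1+ suc t ]   = trans (sgn-periodic (position (r , -[1+ t ]))) (sgn-position r -[1+ t ])

-- The three theta identities

module Certificates where
  open import Agda.Builtin.FromNat using (Number; fromNat)
  open import Agda.Builtin.FromNeg using (Negative; fromNeg)
  import Data.Nat.Literals
  import Data.Integer.Literals

  private instance
    numberℕ : Number ℕ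
    numberℕ = Data.Nat.Literals.number
    numberℤ : Number ℤ
    numberℤ = Data.Integer.Literals.number
    negativeℤ : Negative ℤ
    negativeℤ = Data.Integer.Literals.negative

  -- (q, q⁷, q⁸; q⁸)_∞ (q⁶, q¹⁰; q¹⁶)_∞
  quintuple₁ : Unary.Combo
  quintuple₁ = (1 , θ 12 -1 0) ∷ (-1 , θ 12 7 1) ∷ []

  -- (q⁴, q⁶, q¹⁰; q¹⁰)_∞ / (q³, q⁷; q¹⁰)_∞
  quintuple₂ : Unary.Combo
  quintuple₂ = (1 , θ 60 -8 0) ∷ (-1 , θ 60 52 11) ∷ (1 , θ 60 -28 3) ∷ (-1 , θ 60 32 4) ∷ []

  -- In certificate₃ a lattice vector (k , V) stands for the exponent (k² + 20 V² - 69) / 240.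
  -- Adding the vectors divisible by 3 to both sides completes each side to a signed sum over the
  -- multiples of the two primes above 3 in ℤ[√-5], which are exchanged by (2 + √-5) / 3.
  multiplesOf3ˡ multiplesOf3ʳ : Unary.Combo × Unary.Combo
  multiplesOf3ˡ = (1 , θ 60 33 5) ∷ (1 , θ 60 57 14) ∷ [] , (1 , θ 12 6 0) ∷ []
  multiplesOf3ʳ = (1 , θ 12 9 0) ∷ [] , (1 , θ 60 12 2) ∷ (1 , θ 60 48 11) ∷ []

  -- In the old coordinates the first variable becomes x - y under `shear⁺` and x + y under
  -- `shear⁻`, and the residue of this combination is what the split uses. A leaf `identity` keeps a
  -- class as the model to which its partner is brought.
  shear⁺ shear⁻ : Affine
  shear⁺ = affine 1 1 0 0 1 0
  shear⁻ = affine 1 -1 0 0 1 0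

  -- The exponents are (u² + 2v² - 11) / 16 on the left, with u ≡ 5 and v ≡ 7 modulo 8, and (s² +
  -- 32t² - 33) / 48 on the right. Up to the sign of t they are related by s + 4t√-2 = (1 + √-2)(u +
  -- v√-2). On the right t is prime to 3; the classes on the left in which 3 divides u + v cancel
  -- among themselves. The right side is split modulo 2 because the signs on the left depend on s
  -- modulo 16, whereas a single theta series fixes s modulo 24.
  certificate₁ : List Certificate
  certificate₁ =
    shear⁻ ▹ (identity ∷ identity ∷ identity ∷ []) ∷
    shear⁻ ▹ (identity ∷ identity ∷ (affine -1 0 -1 -2 1 -1) ∷ []) ∷
    shear⁻ ▹ (identity ∷ identity ∷ identity ∷ []) ∷
    shear⁻ ▹ ((affine -1 0 -1 -2 1 -2) ∷ identity ∷ identity ∷ []) ∷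
    identity ▹ ((affine 1 -1 0 1 0 0) ∷ (affine 1 -1 0 1 0 1) ∷ []) ∷
    identity ▹ ((affine 1 -1 0 1 0 0) ∷ (affine 1 -1 0 1 0 0) ∷ []) ∷
    identity ▹ ((affine 1 -1 0 -1 0 0) ∷ (affine 1 -1 -1 -1 0 0) ∷ []) ∷
    identity ▹ ((affine 1 -1 0 -1 0 -1) ∷ (affine 1 -1 0 -1 0 -1) ∷ []) ∷
    []

  -- The exponents are (m² + 3n² - 7) / 15 on the left and (3s² + 25t² - 28) / 60 on the right,
  -- related up to signs by 5t + s√-3 = (1 - √-3)(m + n√-3). On the right s and t are odd, which
  -- means that m + n is odd. The classes with m ≡ n modulo 2 cancel on the left: they are preserved
  -- by multiplication by (1 + √-3) / 2 followed by conjugation.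
  certificate₂ : List Certificate
  certificate₂ =
    shear⁻ ▹ (identity ∷ identity ∷ []) ∷
    shear⁻ ▹ (identity ∷ identity ∷ []) ∷
    shear⁻ ▹ (identity ∷ identity ∷ []) ∷
    shear⁻ ▹ (identity ∷ identity ∷ []) ∷
    shear⁻ ▹ ((affine -1 0 0 -3 1 0) ∷ (affine -1 0 -1 -3 1 -2) ∷ []) ∷
    shear⁻ ▹ (identity ∷ identity ∷ []) ∷
    shear⁻ ▹ (identity ∷ identity ∷ []) ∷
    shear⁻ ▹ ((affine -1 0 -1 -3 1 -2) ∷ (affine -1 0 -1 -3 1 -1) ∷ []) ∷
    shear⁻ ▹ ((affine 2 -1 0 1 0 0) ∷ (affine 2 -1 1 1 0 1) ∷ []) ∷
    shear⁻ ▹ ((affine 1 -1 0 -1 0 -1) ∷ (affine 1 -1 0 -1 0 -1) ∷ []) ∷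
    shear⁻ ▹ ((affine 1 -1 0 -1 0 0) ∷ (affine 1 -1 -1 -1 0 0) ∷ []) ∷
    shear⁻ ▹ ((affine 2 -1 0 1 0 0) ∷ (affine 2 -1 0 1 0 0) ∷ []) ∷
    []

  -- Vectors are k + 2V√-5 on the left and 4m + s√-5 on the right, where the exponent is (5s² + 16m²
  -- - 69) / 240. In both products the coordinates are prime to 3 and the norm is divisible by 3, so
  -- each vector is a multiple of exactly one of the two primes above 3.
  certificate₃ : List Certificate
  certificate₃ =
    shear⁻ ▹ (identity ∷ identity ∷ identity ∷ []) ∷
    shear⁻ ▹ (identity ∷ identity ∷ identity ∷ []) ∷
    shear⁺ ▹ (identity ∷ identity ∷ identity ∷ []) ∷
    shear⁺ ▹ (identity ∷ identity ∷ identity ∷ []) ∷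
    shear⁺ ▹ (identity ∷ identity ∷ identity ∷ []) ∷
    shear⁺ ▹ (identity ∷ identity ∷ identity ∷ []) ∷
    shear⁺ ▹ (identity ∷ identity ∷ identity ∷ []) ∷
    shear⁺ ▹ (identity ∷ identity ∷ identity ∷ []) ∷
    -- This entry and the next three are the multiples of 3; they return negated as the last four.
    -- The two copies of each series are sheared in opposite directions, one cut by x - y and the
    -- other by x + y modulo 3. Cut alike, they would merely cancel each other.
    shear⁺ ▹ (identity ∷ identity ∷ identity ∷ []) ∷
    shear⁻ ▹ (identity ∷ identity ∷ identity ∷ []) ∷
    shear⁻ ▹ ((affine 1 0 0 -2 1 0) ∷ (affine 1 0 0 -2 -1 -1) ∷ identity ∷ []) ∷
    shear⁻ ▹ ((affine -1 0 -1 2 1 1) ∷ (affine 1 0 0 -2 -1 -2) ∷ identity ∷ []) ∷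
    shear⁺ ▹ ((affine -1 0 0 -2 1 0) ∷ (affine 1 0 0 2 1 1) ∷ (affine -1 0 -1 -2 -1 -1) ∷ []) ∷
    shear⁺ ▹ (identity ∷ (affine -1 0 -1 -2 -1 -2) ∷ (affine -1 0 -1 -2 1 -1) ∷ []) ∷
    shear⁻ ▹ ((affine 1 0 0 -2 -1 0) ∷ (affine 1 0 0 -2 1 0) ∷ (affine -1 0 -1 2 1 1) ∷ []) ∷
    shear⁻ ▹ ((affine -1 0 0 2 1 0) ∷ (affine 1 0 0 -2 -1 -1) ∷ identity ∷ []) ∷
    shear⁻ ▹ ((affine 1 0 0 -2 -1 0) ∷ identity ∷ (affine -1 0 -1 2 1 1) ∷ []) ∷
    shear⁻ ▹ ((affine -1 0 -1 2 1 1) ∷ (affine 1 0 0 -2 -1 -2) ∷ (affine 1 0 0 -2 1 -2) ∷ []) ∷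
    shear⁺ ▹ ((affine -1 0 -1 -2 1 -1) ∷ identity ∷ (affine -1 0 -1 -2 -1 0) ∷ []) ∷
    shear⁺ ▹ ((affine 1 0 0 2 1 0) ∷ (affine -1 0 -1 -2 -1 -2) ∷ (affine -1 0 -1 -2 1 -1) ∷ []) ∷
    shear⁻ ▹ ((affine -1 0 -1 -2 -1 -2) ∷ (affine 1 0 0 2 -1 1) ∷ (affine 1 0 -1 2 -1 -1) ∷ []) ∷
    shear⁺ ▹ ((affine -1 0 -1 2 1 2) ∷ (affine 1 0 0 -2 -1 -1) ∷ (affine 1 0 0 -2 -1 -2) ∷ []) ∷
    shear⁺ ▹ ((affine 1 0 0 2 1 0) ∷ (affine -1 0 -1 -2 1 -1) ∷ (affine -1 0 -1 -2 -1 -1) ∷ []) ∷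
    shear⁺ ▹ ((affine 1 0 0 2 1 0) ∷ (affine -1 0 -1 -2 -1 -2) ∷ (affine 1 0 0 2 -1 1) ∷ []) ∷
    []

open Certificates

-- The left-hand side as a theta series

branch : Fin 4 → Theta
branch Fin.zero                               = θ 60 (+ 7) 0
branch (Fin.suc Fin.zero)                     = θ 60 (+ 17) 1
branch (Fin.suc (Fin.suc Fin.zero))           = θ 60 (+ 23) 2
branch (Fin.suc (Fin.suc (Fin.suc Fin.zero))) = θ 60 (+ 47) 9

squares : Unary.Combo
squares = tabulate (λ r → signOf r , branch r)

value-branch : ∀ r j → let l = + 120 ℤ.* j ℤ.+ + offset r in + 240 ℤ.* value (branch r) j ℤ.+ + 49 ≡ l ℤ.* l
value-branch r j = Fin4-elim
  (λ r → let l = + 120 ℤ.* j ℤ.+ + offset r in + 240 ℤ.* value (branch r) j ℤ.+ + 49 ≡ l ℤ.* l)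
  (complete (+ 7) (+ 0) refl) (complete (+ 17) (+ 1) refl) (complete (+ 23) (+ 2) refl) (complete (+ 47) (+ 9) refl) r
  where
  -- Completing the square, to be used at e = 60, where 4e and 2e evaluate to 240 and 120.
  lemma : ∀ e j c F s → (e ℤ.+ e ℤ.+ e ℤ.+ e) ℤ.* (e ℤ.* (j ℤ.* j) ℤ.+ c ℤ.* j ℤ.+ F) ℤ.+ s
    ≡ ((e ℤ.+ e) ℤ.* j ℤ.+ c) ℤ.* ((e ℤ.+ e) ℤ.* j ℤ.+ c) ℤ.+ ((e ℤ.+ e ℤ.+ e ℤ.+ e) ℤ.* F ℤ.+ s ℤ.- c ℤ.* c)
  lemma = solve-∀
  complete : ∀ c F → + 240 ℤ.* F ℤ.+ + 49 ℤ.- c ℤ.* c ≡ + 0 →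
    + 240 ℤ.* (+ 60 ℤ.* (j ℤ.* j) ℤ.+ c ℤ.* j ℤ.+ F) ℤ.+ + 49 ≡ (+ 120 ℤ.* j ℤ.+ c) ℤ.* (+ 120 ℤ.* j ℤ.+ c)
  complete c F eq = trans (lemma (+ 60) j c F (+ 49))
    (trans (cong (λ z → (+ 120 ℤ.* j ℤ.+ c) ℤ.* (+ 120 ℤ.* j ℤ.+ c) ℤ.+ z) eq) (ℤₚ.+-identityʳ _))

Σᴸ-applyUpTo : ∀ (h : ℕ → ℕ) m g → Σᴸ (applyUpTo h m) g ≡ Σ< m (g ∘ h)
Σᴸ-applyUpTo h zero    g = refl
Σᴸ-applyUpTo h (suc m) g = trans (cong (λ z → g (h 0) ℤ.+ z) (Σᴸ-applyUpTo (h ∘ suc) m g))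
                                 (sym (Σ<-head m (g ∘ h)))

lhs-isSum : ∀ a → StrictlyIncreasing a → IsSum (λ n → sgn n • mono (a n)) (lhsSeries a)
lhs-isSum a a↑ = isSum-cong (λ _ _ → refl)
  (λ N → trans (Σᴸ-applyUpTo id (suc N) _) (Σ<-cong (suc N) (λ n _ → scale (sgn n) (a n ≡ᵇ N))))
  (isSum-exists ℕₚ._≟_ (λ N → upTo (suc N)) (λ N → Unique.upTo⁺ (suc N)) cover)
  where
  scale : ∀ s b → s ℤ.* (if b then + 1 else + 0) ≡ (if b then s else + 0)
  scale s true  = ℤₚ.*-identityʳ s
  scale s false = ℤₚ.*-zeroʳ s
  cover : ∀ N i n → n ≤ N → i ∈ upTo (suc N) ⊎ sgn i ℤ.* mono (a i) n ≡ + 0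
  cover N i n n≤N with i ℕₚ.≤? N
  ... | yes i≤N = inj₁ (∈.∈-upTo⁺ (s≤s i≤N))
  ... | no  i≰N = inj₂ (trans (cong (sgn i ℤ.*_) (mono-< (a i) n
    (ℕₚ.<-≤-trans (ℕₚ.≤-<-trans n≤N (ℕₚ.≰⇒> i≰N)) (n≤increasing a a↑ i)))) (ℤₚ.*-zeroʳ (sgn i)))

enumeration-unique : ∀ a → StrictlyIncreasing a →
  (∀ m → (∃ λ k → k * k ≡ 240 * m + 49) ⇔ (∃ λ n → a n ≡ m)) →
  ∀ n → a n ≡ proj₁ (square n)
enumeration-unique a a↑ a-enumerates n = ℕₚ.≤-antisym
  (increasing-≤ a c a↑ c↑ (λ n → Equivalence.to (a-enumerates (c n)) (root n , proj₂ (square n))) n)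
  (increasing-≤ c a c↑ a↑ complete n)
  where
  c : ℕ → ℕ
  c n = proj₁ (square n)
  cancel-< : ∀ {x y} → 240 * x + 49 < 240 * y + 49 → x < y
  cancel-< {x} {y} lt = ℕₚ.*-cancelˡ-< 240 x y (ℕₚ.+-cancelʳ-< 49 (240 * x) (240 * y) lt)
  c↑ : StrictlyIncreasing c
  c↑ i j i<j = cancel-< (subst₂ _<_ (proj₂ (square i)) (proj₂ (square j))
    (ℕₚ.*-mono-< (root-increasing i j i<j) (root-increasing i j i<j)))
  complete : ∀ n → ∃ λ m → c m ≡ a n
  complete n =
    let k , k² = Equivalence.from (a-enumerates (a n)) (n , refl)
        m , root-m = root-complete k (a n) k²
    in m , ℕₚ.*-cancelˡ-≡ (c m) (a n) 240 (ℕₚ.+-cancelʳ-≡ 49 (240 * c m) (240 * a n)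
             (trans (sym (proj₂ (square m))) (trans (cong (λ x → x * x) root-m) k²)))

Total-squares : ∀ a → StrictlyIncreasing a →
  (∀ m → (∃ λ k → k * k ≡ 240 * m + 49) ⇔ (∃ λ n → a n ≡ m)) →
  Unary.Total squares (lhsSeries a)
Total-squares a a↑ a-enumerates = Unary.Total-tabulate 4 signOf branch ℤₚ._≟_
  (λ r → isSum-cong (λ j n → cong₂ (λ s z → s ℤ.* (q^ z) n) (sgn-position r j) (exponent r j)) (λ _ → refl))
  (isSum-reindex position locate position-locate locate-position (lhs-isSum a a↑))
  where
  open ≡-Reasoning
  exponent : ∀ r j → + a (position (r , j)) ≡ value (branch r) j
  exponent r j = ℤₚ.*-cancelˡ-≡ (+ 240) _ _ (∙-cancelʳ (AbelianGroup.group ℤₚ.+-0-abelianGroup) (+ 49) _ _ (begin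
    + 240 ℤ.* + a n ℤ.+ + 49                ≡⟨ cong (ℤ._+ + 49) (ℤₚ.pos-* 240 (a n)) ⟨
    + (240 * a n + 49)                      ≡⟨ cong (λ m → + (240 * m + 49)) (enumeration-unique a a↑ a-enumerates n) ⟩
    + (240 * proj₁ (square n) + 49)         ≡⟨ cong +_ (proj₂ (square n)) ⟨
    + (root n * root n)                     ≡⟨ ℤₚ.pos-* (root n) (root n) ⟩
    + root n ℤ.* + root n                   ≡⟨ root-position² r j ⟩
    (+ 120 ℤ.* j ℤ.+ + offset r) ℤ.* (+ 120 ℤ.* j ℤ.+ + offset r)  ≡⟨ value-branch r j ⟨
    + 240 ℤ.* value (branch r) j ℤ.+ + 49   ∎))
    where
    n = position (r , j)

-- From the theta identities to the product formula

module Regroup {c ℓ} (M : CommutativeMonoid c ℓ) where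
  open CommutativeMonoid M using (_≈_; _∙_) renaming (refl to ≈-refl; ε to 1#)
  open CommutativeMonoidSolver M using (solve; _⊜_) renaming (_⊕_ to _⊞_; id to ε⊞)

  regroup₁ : ∀ p₁ p₇ p₈ p₆ p₁₀ p₁₆ →
    (((((p₁ ∙ p₇) ∙ p₈) ∙ p₆) ∙ p₁₀) ∙ p₁₆) ≈ (((p₁ ∙ p₇) ∙ p₈) ∙ ((p₆ ∙ p₁₀) ∙ p₁₆))
  regroup₁ = solve 6 (λ p₁ p₇ p₈ p₆ p₁₀ p₁₆ →
    (((((p₁ ⊞ p₇) ⊞ p₈) ⊞ p₆) ⊞ p₁₀) ⊞ p₁₆) ⊜ (((p₁ ⊞ p₇) ⊞ p₈) ⊞ ((p₆ ⊞ p₁₀) ⊞ p₁₆))) ≈-refl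

  -- The units are the empty products with which `finprod` begins. The indices are exponents modulo
  -- 10, the common modulus of all the factors.
  regroup₂ : ∀ p₂ p₃ p₄ p₆ p₇ p₈ p₁₀ →
    ((((((1# ∙ p₂) ∙ p₄) ∙ p₆) ∙ p₈) ∙ p₁₀) ∙ ((p₃ ∙ p₇) ∙ p₁₀))
    ≈ ((((1# ∙ p₂) ∙ p₇) ∙ ((1# ∙ p₃) ∙ p₈)) ∙ (((p₄ ∙ p₆) ∙ p₁₀) ∙ p₁₀))
  regroup₂ = solve 7 (λ p₂ p₃ p₄ p₆ p₇ p₈ p₁₀ →
    ((((((ε⊞ ⊞ p₂) ⊞ p₄) ⊞ p₆) ⊞ p₈) ⊞ p₁₀) ⊞ ((p₃ ⊞ p₇) ⊞ p₁₀))
    ⊜ ((((ε⊞ ⊞ p₂) ⊞ p₇) ⊞ ((ε⊞ ⊞ p₃) ⊞ p₈)) ⊞ (((p₄ ⊞ p₆) ⊞ p₁₀) ⊞ p₁₀))) ≈-refl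

open Regroup ⊛-commutativeMonoid

1≤1+n : ∀ {n} → 1 ≤ suc n
1≤1+n = s≤s z≤n

triple : ℕ → ℕ → PS
triple a b = poch a (a + b) ⊛ poch b (a + b) ⊛ poch (a + b) (a + b)

-- Dissection modulo 3 gives (q^R; q^R)_∞ = f(R, 2R), as in the pentagonal number theorem, so that a
-- lone product also becomes a theta series.
poch-triple : ∀ r → poch (suc r) (suc r) ≗ triple (suc r) (suc r + suc r)
poch-triple r n = begin
  poch R R n
    ≡⟨ poch-split 2 R R 1≤1+n 1≤1+n n ⟩
  (one ⊛ poch (R + R * 0) (R * 3) ⊛ poch (R + R * 1) (R * 3) ⊛ poch (R + R * 2) (R * 3)) n
    ≡⟨ ⊛-congʳ (poch (R + R * 2) (R * 3)) (⊛-congʳ (poch (R + R * 1) (R * 3)) (⊛-identityˡ (poch (R + R * 0) (R * 3)))) n ⟩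
  (poch (R + R * 0) (R * 3) ⊛ poch (R + R * 1) (R * 3) ⊛ poch (R + R * 2) (R * 3)) n
    ≡⟨ rename (e₀ R) (e₁ R) (e₂ R) (e₃ R) ⟩
  triple R (R + R) n ∎
  where
  open ≡-Reasoning
  R = suc r
  e₀ : ∀ R → R + R * 0 ≡ R
  e₀ = ℕ-solve-∀
  e₁ : ∀ R → R + R * 1 ≡ R + R
  e₁ = ℕ-solve-∀
  e₂ : ∀ R → R + R * 2 ≡ R + (R + R)
  e₂ = ℕ-solve-∀
  e₃ : ∀ R → R * 3 ≡ R + (R + R)
  e₃ = ℕ-solve-∀
  rename : ∀ {x x′ y y′ z z′ k k′} → x ≡ x′ → y ≡ y′ → z ≡ z′ → k ≡ k′ →
    (poch x k ⊛ poch y k ⊛ poch z k) n ≡ (poch x′ k′ ⊛ poch y′ k′ ⊛ poch z′ k′) n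
  rename refl refl refl refl = refl

s₁ s₂ numerator denominator : PS
s₁ = proj₁ (Total-thetas quintuple₁)
s₂ = proj₁ (Total-thetas quintuple₂)
numerator = poch 1 8 ⊛ poch 7 8 ⊛ poch 8 8 ⊛ poch 6 16 ⊛ poch 10 16
denominator = poch 2 5 ⊛ poch 3 5

-- The closing `refl` evaluates `cancel` on 20 pieces, 12 from the left and 8 from the right; the
-- other two identities have 24 and 72 pieces.
quintupleProduct₁ : triple 1 7 ⊛ triple 6 10 ≗ s₁ ⊛ triple 16 32
quintupleProduct₁ = Total-check certificate₁ (jacobi 1 3 ⊗ jacobi 6 2) (quintuple₁ ⊗ jacobi 16 8)
  (Total-⊗ (jacobi 1 3) (jacobi 6 2) (Total-jacobi 1 3 1≤1+n) (Total-jacobi 6 2 1≤1+n))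
  (Total-⊗ quintuple₁ (jacobi 16 8) (proj₂ (Total-thetas quintuple₁)) (Total-jacobi 16 8 1≤1+n))
  refl

quintupleProduct₂ : s₂ ⊛ triple 3 7 ≗ triple 4 6 ⊛ triple 10 20
quintupleProduct₂ = Total-check certificate₂ (quintuple₂ ⊗ jacobi 3 2) (jacobi 4 1 ⊗ jacobi 10 5)
  (Total-⊗ quintuple₂ (jacobi 3 2) (proj₂ (Total-thetas quintuple₂)) (Total-jacobi 3 2 1≤1+n))
  (Total-⊗ (jacobi 4 1) (jacobi 10 5) (Total-jacobi 4 1 1≤1+n) (Total-jacobi 10 5 1≤1+n))
  refl

Total-⊗-thetas : ∀ us vs → ∃ (Binary.Total (us ⊗ vs))
Total-⊗-thetas us vs =
  proj₁ (Total-thetas us) ⊛ proj₁ (Total-thetas vs) ,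
  Total-⊗ us vs (proj₂ (Total-thetas us)) (proj₂ (Total-thetas vs))

Total-∃-++ : ∀ xs ys → ∃ (Binary.Total xs) → ∃ (Binary.Total ys) → ∃ (Binary.Total (xs ++ ys))
Total-∃-++ xs ys (s , p) (t , q) = s ⊕ t , Binary.Total-++ xs p q

multiplesOf3 : Binary.Combo
multiplesOf3 = (proj₁ multiplesOf3ˡ ⊗ proj₂ multiplesOf3ˡ) ++ (proj₁ multiplesOf3ʳ ⊗ proj₂ multiplesOf3ʳ)

Total-multiplesOf3 : ∃ (Binary.Total multiplesOf3)
Total-multiplesOf3 = Total-∃-++ (proj₁ multiplesOf3ˡ ⊗ proj₂ multiplesOf3ˡ) (proj₁ multiplesOf3ʳ ⊗ proj₂ multiplesOf3ʳ)
  (Total-⊗-thetas (proj₁ multiplesOf3ˡ) (proj₂ multiplesOf3ˡ)) (Total-⊗-thetas (proj₁ multiplesOf3ʳ) (proj₂ multiplesOf3ʳ))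

-- An auxiliary combination may be added to both sides as long as it has some total, which is then
-- cancelled. Here it is `multiplesOf3`.
Total-check-++ : ∀ Cs xs ys zs {s t u} → Binary.Total xs s → Binary.Total ys t → Binary.Total zs u →
  cancel (expandAll Cs ((xs ++ zs) ++ Binary.negate (ys ++ zs))) ≡ [] → s ≗ t
Total-check-++ Cs xs ys zs {s} {t} {u} p q r eq n =
  ∙-cancelʳ (AbelianGroup.group ℤₚ.+-0-abelianGroup) (u n) (s n) (t n)
    (Total-check Cs (xs ++ zs) (ys ++ zs) (Binary.Total-++ xs p r) (Binary.Total-++ ys q r) eq n)

squares-⊛ : ∀ L → Unary.Total squares L → L ⊛ triple 2 4 ≗ s₁ ⊛ s₂
squares-⊛ L total = Total-check-++ certificate₃ (squares ⊗ jacobi 2 1) (quintuple₁ ⊗ quintuple₂) multiplesOf3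
  (Total-⊗ squares (jacobi 2 1) total (Total-jacobi 2 1 1≤1+n))
  (Total-⊗ quintuple₁ quintuple₂ (proj₂ (Total-thetas quintuple₁)) (proj₂ (Total-thetas quintuple₂)))
  (proj₂ Total-multiplesOf3)
  refl

-- The factor (q¹⁶; q¹⁶)_∞ completes (q⁶, q¹⁰; q¹⁶)_∞ to a triple product; it can be cancelled
-- afterwards because its constant term is 1.
numerator≗s₁ : numerator ≗ s₁
numerator≗s₁ = ⊛-cancelˡ (poch 16 16) numerator s₁ refl λ n → begin
  (poch 16 16 ⊛ numerator) n    ≡⟨ ⊛-comm (poch 16 16) numerator n ⟩
  (numerator ⊛ poch 16 16) n    ≡⟨ regroup₁ (poch 1 8) (poch 7 8) (poch 8 8) (poch 6 16) (poch 10 16) (poch 16 16) n ⟩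
  (triple 1 7 ⊛ triple 6 10) n  ≡⟨ quintupleProduct₁ n ⟩
  (s₁ ⊛ triple 16 32) n         ≡⟨ ⊛-congˡ s₁ (poch-triple 15) n ⟨
  (s₁ ⊛ poch 16 16) n           ≡⟨ ⊛-comm s₁ (poch 16 16) n ⟩
  (poch 16 16 ⊛ s₁) n           ∎
  where open ≡-Reasoning

-- This identifies S with `s₂` without a division. Dissecting (q²; q²)_∞ and D modulo 10 gives (q²;
-- q²)_∞ f(3,7) = D f(4,6) (q¹⁰; q¹⁰)_∞, and f(3,7) is cancelled after `quintupleProduct₂`.
triple-2-4 : triple 2 4 ≗ denominator ⊛ s₂
triple-2-4 = ⊛-cancelˡ (triple 3 7) (triple 2 4) (denominator ⊛ s₂) refl λ n → begin
  (triple 3 7 ⊛ triple 2 4) n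
    ≡⟨ ⊛-comm (triple 3 7) (triple 2 4) n ⟩
  (triple 2 4 ⊛ triple 3 7) n
    ≡⟨ ⊛-congʳ (triple 3 7) (poch-triple 1) n ⟨
  (poch 2 2 ⊛ triple 3 7) n
    ≡⟨ ⊛-congʳ (triple 3 7) (poch-split 4 2 2 1≤1+n 1≤1+n) n ⟩
  ((one ⊛ poch 2 10 ⊛ poch 4 10 ⊛ poch 6 10 ⊛ poch 8 10 ⊛ poch 10 10) ⊛ triple 3 7) n
    ≡⟨ regroup₂ (poch 2 10) (poch 3 10) (poch 4 10) (poch 6 10) (poch 7 10) (poch 8 10) (poch 10 10) n ⟩
  (((one ⊛ poch 2 10 ⊛ poch 7 10) ⊛ (one ⊛ poch 3 10 ⊛ poch 8 10)) ⊛ (triple 4 6 ⊛ poch 10 10)) n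
    ≡⟨ ⊛-cong {denominator} {(one ⊛ poch 2 10 ⊛ poch 7 10) ⊛ (one ⊛ poch 3 10 ⊛ poch 8 10)}
              {s₂ ⊛ triple 3 7} {triple 4 6 ⊛ poch 10 10}
         (⊛-cong {poch 2 5} {one ⊛ poch 2 10 ⊛ poch 7 10} {poch 3 5} {one ⊛ poch 3 10 ⊛ poch 8 10}
           (poch-split 1 2 5 1≤1+n 1≤1+n) (poch-split 1 3 5 1≤1+n 1≤1+n))
         (λ i → trans (quintupleProduct₂ i) (⊛-congˡ (triple 4 6) (λ j → sym (poch-triple 9 j)) i)) n ⟨
  (denominator ⊛ (s₂ ⊛ triple 3 7)) n
    ≡⟨ ⊛-assoc denominator s₂ (triple 3 7) n ⟨
  (denominator ⊛ s₂ ⊛ triple 3 7) n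
    ≡⟨ ⊛-comm (denominator ⊛ s₂) (triple 3 7) n ⟩
  (triple 3 7 ⊛ (denominator ⊛ s₂)) n ∎
  where open ≡-Reasoning

squares-denominator : ∀ L → Unary.Total squares L → L ⊛ denominator ≗ numerator
squares-denominator L total n = trans (⊛-cancelˡ s₂ (L ⊛ denominator) s₁ refl (λ i → begin
  (s₂ ⊛ (L ⊛ denominator)) i     ≡⟨ ⊛-comm s₂ (L ⊛ denominator) i ⟩
  (L ⊛ denominator ⊛ s₂) i       ≡⟨ ⊛-assoc L denominator s₂ i ⟩
  (L ⊛ (denominator ⊛ s₂)) i     ≡⟨ ⊛-congˡ L triple-2-4 i ⟨
  (L ⊛ triple 2 4) i             ≡⟨ squares-⊛ L total i ⟩
  (s₁ ⊛ s₂) i                    ≡⟨ ⊛-comm s₁ s₂ i ⟩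
  (s₂ ⊛ s₁) i                    ∎) n) (sym (numerator≗s₁ n))
  where open ≡-Reasoning

theorem8 : (a : ℕ → ℕ)
    → (∀ i j → i < j → a i < a j)
    → (∀ m → (∃ λ k → k * k ≡ 240 * m + 49) ⇔ (∃ λ n → a n ≡ m))
    → ∀ N → lhsSeries a N ≡ rhsSeries N
theorem8 a a↑ a-enumerates N = begin
  L N                                         ≡⟨ ⊛-identityʳ L N ⟨
  (L ⊛ one) N                                 ≡⟨ ⊛-congˡ L (⊛-inverseʳ denominator refl) N ⟨
  (L ⊛ (denominator ⊛ inv denominator)) N     ≡⟨ ⊛-assoc L denominator (inv denominator) N ⟨
  (L ⊛ denominator ⊛ inv denominator) N       ≡⟨ ⊛-congʳ (inv denominator) (squares-denominator L (Total-squares a a↑ a-enumerates)) N ⟩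
  rhsSeries N                                 ∎
  where
  open ≡-Reasoning
  L = lhsSeries a
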